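{- Let $n,p$ be positive coprime integers and $\omega\in\widetilde{\mathfrak S}_n$ a dominant $p$-stable affine permutation. Then the complement of $\zeta(\mathcal A(\omega))$ equals the partition $(f_n(\omega),f_{n-1}(\omega),\dots,f_1(\omega))$ (the reversed Pak--Stanley labelling), and the complement of $\eta(\mathcal A(\omega))$ equals $(f^*_n(\omega),\dots,f^*_1(\omega))$ (the reversed dual Pak--Stanley labelling).
   Context: $\widetilde{\mathfrak S}_n$ is the group of bijections $\omega:\mathbb Z\to\mathbb Z$ with $\omega(i+n)=\omega(i)+n$ and $\omega(1)+\dots+\omega(n)=n(n+1)/2$; $\omega$ is dominant if $\omega^{ -1}(1)<\dots<\omega^{ -1}(n)$ and $p$-stable if $\omega(i)<\omega(i+p)$ for all $i$. The involution $\omega\mapsto\omega^*$ is given by $\omega^*(i)=1-\omega(1-i)$. The Pak--Stanley labelling is $f_i(\omega)=\#\{(a,b)\in[n]\times\mathbb N: a<b<a+p,\ \omega(a)>\omega(b),\ \omega(b)\equiv i\pmod n\}$ for $i\in[n]$, and the dual labelling is $f_i^*(\omega)=f_i(\omega^*)$. A rational Dyck path is a lattice path from $(0,0)$ with $n$ North steps $N=(0,1)$ and $p$ East steps $E=(1,0)$ never going below the line of slope $n/p$ through the origin; $\mathfrak D_{n,p}$ is the set of these. The point $(i,j)$ (or unit square with bottom-right corner $(i,j)$) has label $\ell_{i,j}=jp-in$; each step gets the label of its starting point. $H(x)$ is the set of positive labels of unit squares below $x$ (between $x$ and the diagonal). The zeta map: if $x=x_1\cdots x_{n+p}$, then $\zeta(x)=x_{\sigma(1)}\cdots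 x_{\sigma(n+p)}$ where $\sigma$ orders the steps so that their labels are increasing. The complement of a path $y\in\mathfrak D_{n,p}$ is the partition $(\lambda_1\ge\dots\ge\lambda_n\ge0)$ where $\lambda_j$ is the number of East steps of $y$ preceding its $(n+1-j)$-th North step. For a finite set $H$ of positive integers there is a unique partition whose first-column hook lengths are exactly $H$; $\varphi(x)$ is the partition with first-column hook length set $H(x)$, and $\varphi$ is a bijection from $\mathfrak D_{n,p}$ onto the set of $n,p$-cores (Anderson). The eta map is $\eta(x)=\zeta(\varphi^{ -1}(\varphi(x)'))$ where $'$ denotes the conjugate partition. For a partition $\kappa$ let $\alpha(\kappa)=\{\kappa_i+1-i:i\ge1\}$ ($\kappa_i=0$ for $i>\ell(\kappa)$) and $\gamma(\omega)=\{z\in\mathbb Z:\omega(z)\le0\}$; for dominant $p$-stable $\omega$ there is a unique $n,p$-core $\kappa$ with $\alpha(\kappa)=\gamma(\omega)$, and $\mathcal A(\omega)=\varphi^{ -1}(\kappa)$. -}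

module Defs where

open import Data.Nat as ℕ using (ℕ; zero; suc; NonZero; _∸_; _⊔_)
import Data.Nat.Properties as ℕP
open import Data.Integer as ℤ using (ℤ; +_; _-_; _+_; _≤_; _<_; ∣_∣)
import Data.Integer.Properties as ℤP
open import Data.Integer.DivMod using (_%ℕ_)
open import Data.Nat.DivMod using (_%_; _/_)
open import Data.List using (List; []; _∷_; map; filter; length; reverse; applyUpTo; concatMap; foldr; _++_)
open import Data.Nat.ListAction using (sum)
import Data.List.Properties as LP
open import Data.List.Relation.Unary.All using (All; all?)
open import Data.Product using (_×_; _,_; proj₁; proj₂; Σ; ∃)
open import Data.Product.Relation.Binary.Pointwise.NonDependent using ()
open import Data.Maybe using (Maybe; just; nothing)
open import Relation.Nullary using (Dec; yes; no; ¬_)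
open import Relation.Nullary.Decidable using (_×-dec_; ⌊_⌋)
open import Relation.Binary.PropositionalEquality using (_≡_)
open import Function.Definitions using (Bijective)

windowSum : ℕ → (ℤ → ℤ) → ℤ
windowSum n ω = foldr _+_ (+ 0) (applyUpTo (λ k → ω (+ suc k)) n)

IsAffinePerm : ℕ → (ℤ → ℤ) → Set
IsAffinePerm n ω =
  Bijective _≡_ _≡_ ω
  × (∀ i → ω (i + + n) ≡ ω i + + n)
  × (windowSum n ω ≡ + ((n ℕ.* suc n) / 2))

-- dominant: ω⁻¹(1) < ω⁻¹(2) < … < ω⁻¹(n), i.e. for a,b with
-- 1 ≤ ω(a) < ω(b) ≤ n we have a < b.
Dominant : ℕ → (ℤ → ℤ) → Set
Dominant n ω = ∀ a b → + 1 ≤ ω a → ω a < ω b → ω b ≤ + n → a < b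

Stable : ℕ → (ℤ → ℤ) → Set
Stable p ω = ∀ i → ω i < ω (i + + p)

dual : (ℤ → ℤ) → (ℤ → ℤ)
dual ω i = + 1 - ω (+ 1 - i)

PS : (n p : ℕ) .{{_ : NonZero n}} → (ℤ → ℤ) → ℕ → ℕ
PS n p ω i = sum (map countB (applyUpTo suc n))
  where
    countB : ℕ → ℕ
    countB a = length (filter (λ b → (ω (+ b) ℤ.<? ω (+ a)) ×-dec (ω (+ b) %ℕ n ℕ.≟ i % n))
                              (applyUpTo (λ k → a ℕ.+ suc k) (p ∸ 1)))

PS* : (n p : ℕ) .{{_ : NonZero n}} → (ℤ → ℤ) → ℕ → ℕ
PS* n p ω i = PS n p (dual ω) i

data Step : Set where
  N E : Step

Path : Set
Path = List Step

countN countE : Path → ℕ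
countN [] = 0
countN (N ∷ s) = suc (countN s)
countN (E ∷ s) = countN s
countE [] = 0
countE (N ∷ s) = countE s
countE (E ∷ s) = suc (countE s)

vertices : ℕ → ℕ → Path → List (ℕ × ℕ)
vertices i j [] = (i , j) ∷ []
vertices i j (N ∷ s) = (i , j) ∷ vertices i (suc j) s
vertices i j (E ∷ s) = (i , j) ∷ vertices (suc i) j s

annotate : ℕ → ℕ → Path → List ((ℕ × ℕ) × Step)
annotate i j [] = []
annotate i j (N ∷ s) = ((i , j) , N) ∷ annotate i (suc j) s
annotate i j (E ∷ s) = ((i , j) , E) ∷ annotate (suc i) j s

-- x ∈ 𝔇_{n,p}: n North steps, p East steps, never below the line
-- y = (n/p) x, i.e. every visited point (i,j) has i n ≤ j p.
IsDyck : ℕ → ℕ → Path → Set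
IsDyck n p x = countN x ≡ n × countE x ≡ p
               × All (λ v → proj₁ v ℕ.* n ℕ.≤ proj₂ v ℕ.* p) (vertices 0 0 x)

isDyck? : ∀ n p x → Dec (IsDyck n p x)
isDyck? n p x = (countN x ℕ.≟ n) ×-dec (countE x ℕ.≟ p)
                ×-dec all? (λ v → proj₁ v ℕ.* n ℕ.≤? proj₂ v ℕ.* p) (vertices 0 0 x)

label : ℕ → ℕ → ℕ → ℕ → ℤ
label n p i j = + (j ℕ.* p) - + (i ℕ.* n)

insertByLabel : ℤ × Step → List (ℤ × Step) → List (ℤ × Step)
insertByLabel x [] = x ∷ []
insertByLabel x (y ∷ ys) with proj₁ x ℤ.≤? proj₁ y
... | yes _ = x ∷ y ∷ ys
... | no  _ = y ∷ insertByLabel x ys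

sortByLabel : List (ℤ × Step) → List (ℤ × Step)
sortByLabel = foldr insertByLabel []

zeta : ℕ → ℕ → Path → Path
zeta n p x = map proj₂ (sortByLabel
               (map (λ q → label n p (proj₁ (proj₁ q)) (proj₂ (proj₁ q)) , proj₂ q)
                    (annotate 0 0 x)))

eBefore : ℕ → Path → List ℕ
eBefore e [] = []
eBefore e (N ∷ s) = e ∷ eBefore e s
eBefore e (E ∷ s) = eBefore (suc e) s

complement : Path → List ℕ
complement x = reverse (eBefore 0 x)

-- H(x): positive labels of the unit squares below x.  The square with
-- bottom-right corner (i+1 , k) lies below x iff the East step of x
-- from column i to i+1 is at height ≥ k+1.
H : ℕ → ℕ → Path → List ℕ
H n p x = concatMap sq (annotate 0 0 x)
  where
    sq : (ℕ × ℕ) × Step → List ℕ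
    sq ((i , j) , N) = []
    sq ((i , j) , E) =
      map ∣_∣ (filter (λ l → + 0 ℤ.<? l) (applyUpTo (λ k → label n p (suc i) k) j))

-- partitions are lists of positive parts in weakly decreasing order
Partition : Set
Partition = List ℕ

insertDesc : ℕ → List ℕ → List ℕ
insertDesc x [] = x ∷ []
insertDesc x (y ∷ ys) with y ℕ.≤? x
... | yes _ = x ∷ y ∷ ys
... | no  _ = y ∷ insertDesc x ys

sortDesc : List ℕ → List ℕ
sortDesc = foldr insertDesc []

-- the unique partition whose first-column hook lengths are the
-- (distinct) elements of the list: h₁ > … > h_ℓ ↦ κ_i = h_i - (ℓ - i)
fromHooks′ : List ℕ → Partition
fromHooks′ [] = []
fromHooks′ (h ∷ hs) = (h ∸ length hs) ∷ fromHooks′ hs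

partitionWithHooks : List ℕ → Partition
partitionWithHooks hs = fromHooks′ (sortDesc hs)

φ : ℕ → ℕ → Path → Partition
φ n p x = partitionWithHooks (H n p x)

conj : Partition → Partition
conj κ = applyUpTo (λ j → length (filter (λ k → suc j ℕ.≤? k) κ)) (foldr _⊔_ 0 κ)

words : ℕ → List Path
words zero = [] ∷ []
words (suc k) = map (N ∷_) (words k) ++ map (E ∷_) (words k)

-- φ⁻¹(κ): the (unique) y ∈ 𝔇_{n,p} with φ(y) = κ, found by search
φ⁻¹ : ℕ → ℕ → Partition → Maybe Path
φ⁻¹ n p κ with filter (λ y → isDyck? n p y ×-dec LP.≡-dec ℕ._≟_ (φ n p y) κ) (words (n ℕ.+ p))
... | [] = nothing
... | y ∷ _ = just y

η : ℕ → ℕ → Path → Maybe Path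
η n p x with φ⁻¹ n p (conj (φ n p x))
... | nothing = nothing
... | just y = just (zeta n p y)

-- α(κ) = {κ_i + 1 - i : i ≥ 1}   (κ_i = 0 for i > ℓ(κ))
nth0 : Partition → ℕ → ℕ
nth0 [] _ = 0
nth0 (k ∷ κ) zero = k
nth0 (k ∷ κ) (suc i) = nth0 κ i

Inα : Partition → ℤ → Set
Inα κ z = ∃ λ i → z ≡ + nth0 κ i - + i      -- i = (row index) - 1

Inγ : (ℤ → ℤ) → ℤ → Set
Inγ ω z = ω z ≤ + 0

αEqγ : Partition → (ℤ → ℤ) → Set
αEqγ κ ω = ∀ z → (Inα κ z → Inγ ω z) × (Inγ ω z → Inα κ z)

-- x = 𝒜(ω):  x ∈ 𝔇_{n,p} and the core κ = φ(x) satisfies α(κ) = γ(ω)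
-- (φ is a bijection from 𝔇_{n,p} onto n,p-cores)
Is𝒜 : ℕ → ℕ → (ℤ → ℤ) → Path → Set
Is𝒜 n p ω x = IsDyck n p x × αEqγ (φ n p x) ω

{-# OPTIONS --safe #-}
-- Shift the complement of γ(ω) so that its minimum is 0 and call the result Δ; it is closed under +n and +p and
-- its gaps are H(x).  Hence the labels of the north steps of x are the minimal elements of Δ modulo n, and those
-- of the east steps are n plus the minimal elements of Δ modulo p.  By dominance the k-th smallest north label is
-- (a shift of) b = ω⁻¹(k).  So the number of east steps before the k-th north step of ζ(x) is the number of
-- residue classes modulo p which Δ + n meets below b, that is, the number of a ∈ [b - p , b - 1] with ω(a) > n.
-- By dominance ω(a) > n may be replaced by ω(a) > k, and by stability a = b - p never occurs: this is f_k(ω).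
--
-- Conversely x is recovered from Δ by walking east whenever that leads to a label in Δ, and north otherwise; the
-- condition on the window sum places the minimum of the complement of γ(ω) at 1 - |H(x)|, as α(φ(x)) requires.
--
-- The dual statement is the first one for ω*, because α(κ′) = {1 - z : z ∉ α(κ)} and γ(ω*) = {1 - z : z ∉ γ(ω)}.
module Submission where

-- Coprimality enters through the labels: in the box from `(0 , 0)` to `(p , n)` the only distinct
-- points that share a label are these two corners. No step starts at `(p , n)`, so the steps of x
-- carry distinct labels and sorting them involves no ties. The same fact keeps the vertices of x
-- apart from the corners of the squares below x, so that every vertex has its label in Δ.
--
-- The shift is `1 - ℓ` with ℓ the size of H(x): a hook length h contributes `h + 1 - ℓ` to α(φ(x)),
-- and the empty rows contribute everything up to `- ℓ`.
--
-- Since η is defined by a search, its value is known only once some path is known to have the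
-- conjugate core; existence of 𝒜 is applied to ω* for this purpose. The first statement is proved
-- for every path satisfying `Is𝒜`, hence also for whichever path the search returns.

open import Defs
open import Algebra.Bundles using (CommutativeMonoid)
open import Data.Empty using (⊥; ⊥-elim)
open import Data.Integer as ℤ using (ℤ; +_; -[1+_]; _+_; _*_; _-_; -_; _≤_; _<_; ∣_∣)
open import Data.Integer.DivMod using (_%ℕ_; _/ℕ_; n%ℕd<d; a≡a%ℕn+[a/ℕn]*n)
import Data.Integer.Properties as ℤP
open import Data.Integer.Tactic.RingSolver using (solve-∀)
open import Data.List using (List; []; _∷_; map; filter; length; reverse; applyUpTo; applyDownFrom; upTo; downFrom; foldr; _++_)
open import Data.List.Membership.Propositional using (_∈_; _∉_; find; lose)
open import Data.List.Membership.Propositional.Properties using (∈-map⁺; ∈-map⁻; ∈-++⁺ˡ; ∈-++⁺ʳ; ∈-concatMap⁺; ∈-concatMap⁻; ∈-applyUpTo⁺; ∈-applyUpTo⁻; ∈-upTo⁺; ∈-filter⁺; ∈-filter⁻)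
open import Data.List.Membership.Propositional.Properties.WithK using (unique∧set⇒bag)
import Data.List.Properties as LP
open import Data.List.Relation.Binary.BagAndSetEquality using (∼bag⇒↭)
open import Data.List.Relation.Binary.Disjoint.Propositional using (Disjoint)
open import Data.List.Relation.Binary.Permutation.Propositional using (_↭_; ↭-refl; ↭-sym; ↭-trans; ↭⇒↭ₛ; prep; swap)
import Data.List.Relation.Binary.Permutation.Propositional.Properties as ↭P
import Data.List.Relation.Binary.Permutation.Setoid.Properties as ↭S
open import Data.List.Relation.Unary.All as All using (All; []; _∷_)
import Data.List.Relation.Unary.All.Properties as AllP
open import Data.List.Relation.Unary.AllPairs as AllPairs using (AllPairs; []; _∷_)
import Data.List.Relation.Unary.AllPairs.Properties as AllPairsP
open import Data.List.Relation.Unary.Any using (here; there)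
open import Data.List.Relation.Unary.Unique.Propositional using (Unique)
import Data.List.Relation.Unary.Unique.Propositional.Properties as UniqueP
open import Data.Maybe using (just)
open import Data.Nat as ℕ using (ℕ; zero; suc; NonZero; _∸_; _⊔_)
open import Data.Nat.Coprimality as Coprimality using (Coprime)
open import Data.Nat.DivMod using (_%_; _/_; m*n/n≡m)
import Data.Nat.Divisibility as Div
open import Data.Nat.GCD using (module Bézout)
open import Data.Nat.ListAction using (sum)
open import Data.Nat.ListAction.Properties using (sum-↭)
import Data.Nat.Properties as ℕP
import Data.Nat.Tactic.RingSolver as ℕRing
open import Data.Product using (_×_; _,_; proj₁; proj₂; ∃)
open import Data.Sum using (_⊎_; inj₁; inj₂)
open import Function.Base using (_∘_; id; _∋_)
open import Function.Bundles using (mk⇔)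
open import Level using (0ℓ)
open import Relation.Binary.Definitions using (tri<; tri≈; tri>)
open import Relation.Binary.PropositionalEquality using (_≡_; _≢_; refl; sym; trans; cong; cong₂; subst; subst₂; setoid; resp₂; module ≡-Reasoning)
open import Relation.Nullary using (Dec; yes; no; ¬_; contradiction)
open import Relation.Nullary.Decidable using (_×-dec_)

-- Linear arithmetic over ℤ

-- Linear inequalities are added up with _⊕_; the goal then follows from an identity between
-- the differences of the two sides, which the ring solver checks.
infixl 5 _⊕_
_⊕_ : ∀ {a b c d} → a ≤ b → c ≤ d → a + c ≤ b + d
_⊕_ = ℤP.+-mono-≤

≤-by : ∀ {a b c d} → a ≤ b → b - a ≡ d - c → c ≤ d
≤-by a≤b eq = ℤP.0≤i-j⇒j≤i (subst (+ 0 ≤_) eq (ℤP.i≤j⇒0≤j-i a≤b))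

<⇒1+≤ : ∀ {a b} → a < b → + 1 + a ≤ b
<⇒1+≤ = ℤP.i<j⇒suc[i]≤j

i<1+i : ∀ i → i < + 1 + i
i<1+i i = ℤP.suc[i]≤j⇒i<j ℤP.≤-refl

i≤+∣i∣ : ∀ i → i ≤ + ∣ i ∣
i≤+∣i∣ (+ _)    = ℤP.≤-refl
i≤+∣i∣ -[1+ _ ] = ℤ.-≤+

pos-∸ : ∀ {m n} → n ℕ.≤ m → + (m ∸ n) ≡ + m - + n
pos-∸ {m} {n} n≤m = trans (sym (ℤP.⊖-≥ n≤m)) (sym (ℤP.m-n≡m⊖n m n))

<-by : ∀ {a b c d} → a ≤ b → b - a ≡ d - (+ 1 + c) → c < d
<-by a≤b eq = ℤP.suc[i]≤j⇒i<j (≤-by a≤b eq)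

+-cancelʳ-< : ∀ n {x y} → x + n < y + n → x < y
+-cancelʳ-< n {x} {y} h = <-by (<⇒1+≤ h) (((∀ n x y → (y + n) - (+ 1 + (x + n)) ≡ y - (+ 1 + x)) ∋ solve-∀) n x y)

≡-by : ∀ {a b c d} → a ≡ b → a - b ≡ c - d → c ≡ d
≡-by {c = c} {d} a≡b eq = ℤP.i-j≡0⇒i≡j c d (trans (sym eq) (ℤP.i≡j⇒i-j≡0 a≡b))

-- The form of every arithmetic refutation below: inequalities are added up until the right side
-- minus the left side is the constant -1.
≤-absurd : ∀ {a b} → a ≤ b → b - a ≡ - + 1 → ⊥
≤-absurd a≤b eq with () ← subst (+ 0 ≤_) eq (ℤP.i≤j⇒0≤j-i a≤b)

≤0⇒¬1≤ : ∀ {a} → a ≤ + 0 → ¬ + 1 ≤ a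
≤0⇒¬1≤ a≤0 1≤a = ≤-absurd (ℤP.≤-trans 1≤a a≤0) refl

¬1≤⇒≤0 : ∀ {a} → ¬ + 1 ≤ a → a ≤ + 0
¬1≤⇒≤0 {a} ¬1≤a with a ℤ.≤? + 0
... | yes a≤0 = a≤0
... | no  a≰0 = contradiction (<⇒1+≤ (ℤP.≰⇒> a≰0)) ¬1≤a

0≤+ : ∀ n → + 0 ≤ + n
0≤+ n = ℤ.+≤+ ℕ.z≤n

-- Residues modulo n

-- As `r < n`, the number `r + q * n` stays below `(q + 1) * n`, hence below any `s + t * n` with
-- `q < t`.
residue-unique-≮ : ∀ n {r s : ℕ} {q t : ℤ} → r ℕ.< n → + r + q * + n ≡ + s + t * + n → ¬ q < t
residue-unique-≮ n {r} {s} {q} {t} r<n eq q<t = ≤-absurd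
  (ℤP.*-monoʳ-≤-nonNeg (+ n) (<⇒1+≤ q<t) ⊕ ℤ.+≤+ r<n ⊕ 0≤+ s ⊕ ℤP.≤-reflexive (sym eq))
  (((∀ n r s q t → (t * n + n + s + (r + q * n)) - ((+ 1 + q) * n + (+ 1 + r) + + 0 + (s + t * n)) ≡ - + 1) ∋
      solve-∀) (+ n) (+ r) (+ s) q t)

residue-unique : ∀ n {r s : ℕ} (q t : ℤ) → r ℕ.< n → s ℕ.< n →
                 + r + q * + n ≡ + s + t * + n → r ≡ s × q ≡ t
residue-unique n {r} {s} q t r<n s<n eq with ℤP.<-cmp q t
... | tri< q<t _ _ = contradiction q<t (residue-unique-≮ n {q = q} {t} r<n eq)
... | tri> _ _ t<q = contradiction t<q (residue-unique-≮ n {q = t} {q} s<n (sym eq))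
... | tri≈ _ refl _ = ℤP.+-injective (≡-by eq (((∀ r s x → (r + x) - (s + x) ≡ r - s) ∋ solve-∀) (+ r) (+ s)
    (q * + n))) , refl

module _ (n : ℕ) .{{_ : NonZero n}} where

  %ℕ-≡ : ∀ {r : ℕ} q → r ℕ.< n → (+ r + q * + n) %ℕ n ≡ r
  %ℕ-≡ {r} q r<n = proj₁ (residue-unique n (z /ℕ n) q (n%ℕd<d z n) r<n (sym (a≡a%ℕn+[a/ℕn]*n z n)))
    where z = + r + q * + n

  %ℕ-+ : ∀ z q → (z + q * + n) %ℕ n ≡ z %ℕ n
  %ℕ-+ z q = trans (cong (_%ℕ n) (trans (cong (_+ q * + n) (a≡a%ℕn+[a/ℕn]*n z n))
    (((∀ r s q n → (r + s * n) + q * n ≡ r + (s + q) * n) ∋ solve-∀) (+ (z %ℕ n)) (z /ℕ n) q (+ n))))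
    (%ℕ-≡ (z /ℕ n + q) (n%ℕd<d z n))

  %ℕ-cong⇒ : ∀ y z → y %ℕ n ≡ z %ℕ n → ∃ λ q → y ≡ z + q * + n
  %ℕ-cong⇒ y z eq = y /ℕ n - z /ℕ n , (begin
    y                             ≡⟨ a≡a%ℕn+[a/ℕn]*n y n ⟩
    + (y %ℕ n) + y /ℕ n * + n     ≡⟨ cong (λ r → + r + y /ℕ n * + n) eq ⟩
    + (z %ℕ n) + y /ℕ n * + n     ≡⟨ ((∀ r a b n → r + a * n ≡ (r + b * n) + (a - b) * n) ∋ solve-∀) (+ (z %ℕ n))
        (y /ℕ n) (z /ℕ n) (+ n) ⟩
    (+ (z %ℕ n) + z /ℕ n * + n) + (y /ℕ n - z /ℕ n) * + n ≡⟨ cong (_+ (y /ℕ n - z /ℕ n) * + n) (a≡a%ℕn+[a/ℕn]*n z n) ⟨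
    z + (y /ℕ n - z /ℕ n) * + n ∎)
    where open ≡-Reasoning

-- Finite sums

-- Stated over a commutative monoid so that counts in ℕ and window sums in ℤ share the same lemmas.
module Sum (M : CommutativeMonoid 0ℓ 0ℓ) where
  open CommutativeMonoid M renaming (Carrier to C; _∙_ to _·_; refl to ≈-refl; sym to ≈-sym; trans to ≈-trans)

  Σ : (ℕ → C) → ℕ → C
  Σ f zero    = ε
  Σ f (suc n) = f 0 · Σ (f ∘ suc) n

  Σ-cong : ∀ {f g} n → (∀ i → i ℕ.< n → f i ≈ g i) → Σ f n ≈ Σ g n
  Σ-cong zero    h = ≈-refl
  Σ-cong (suc n) h = ∙-cong (h 0 ℕ.z<s) (Σ-cong n (λ i → h (suc i) ∘ ℕ.s<s))

  Σ-ε : ∀ {f} n → (∀ i → i ℕ.< n → f i ≈ ε) → Σ f n ≈ ε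
  Σ-ε zero    h = ≈-refl
  Σ-ε (suc n) h = ≈-trans (∙-cong (h 0 ℕ.z<s) (Σ-ε n (λ i → h (suc i) ∘ ℕ.s<s))) (identityˡ ε)

  Σ-last : ∀ f n → Σ f (suc n) ≈ Σ f n · f n
  Σ-last f zero    = comm (f 0) ε
  Σ-last f (suc n) = ≈-trans (∙-congˡ (Σ-last (f ∘ suc) n)) (≈-sym (assoc _ _ _))

  Σ-· : ∀ f g n → Σ (λ i → f i · g i) n ≈ Σ f n · Σ g n
  Σ-· f g zero    = ≈-sym (identityˡ ε)
  Σ-· f g (suc n) = ≈-trans (∙-congˡ (Σ-· (f ∘ suc) (g ∘ suc) n))
    (interchange (f 0) (g 0) _ _)
    where open import Algebra.Properties.CommutativeSemigroup commutativeSemigroup using (interchange)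

  Σ-comm : ∀ (f : ℕ → ℕ → C) m n → Σ (λ i → Σ (f i) n) m ≈ Σ (λ j → Σ (λ i → f i j) m) n
  Σ-comm f zero    n = ≈-sym (Σ-ε n (λ _ _ → ≈-refl))
  Σ-comm f (suc m) n = ≈-trans (∙-congˡ (Σ-comm (f ∘ suc) m n)) (≈-sym (Σ-· _ _ n))

  Σ-++ : ∀ f m n → Σ f (m ℕ.+ n) ≈ Σ f m · Σ (λ i → f (m ℕ.+ i)) n
  Σ-++ f zero    n = ≈-sym (identityˡ _)
  Σ-++ f (suc m) n = ≈-trans (∙-congˡ (Σ-++ (f ∘ suc) m n)) (≈-sym (assoc _ _ _))

  Σ-blocks : ∀ f m n → Σ f (m ℕ.* n) ≈ Σ (λ t → Σ (λ i → f (t ℕ.* n ℕ.+ i)) n) m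
  Σ-blocks f zero    n = ≈-refl
  Σ-blocks f (suc m) n = ≈-trans (Σ-++ f n (m ℕ.* n)) (∙-congˡ (≈-trans (Σ-blocks (λ i → f (n ℕ.+ i)) m n)
    (Σ-cong m (λ t _ → Σ-cong n (λ i _ → reflexive (cong f (sym (ℕP.+-assoc n (t ℕ.* n) i))))))))

  Σ-reverse : ∀ f n → Σ f n ≈ Σ (λ i → f (n ∸ suc i)) n
  Σ-reverse f zero    = ≈-refl
  Σ-reverse f (suc n) = ≈-trans (Σ-last f n) (≈-trans (comm _ _) (∙-congˡ (Σ-reverse f n)))

open Sum ℕP.+-0-commutativeMonoid
module ℤSum = Sum ℤP.+-0-commutativeMonoid

Σ-mono : ∀ {f g} n → (∀ i → f i ℕ.≤ g i) → Σ f n ℕ.≤ Σ g n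
Σ-mono zero    h = ℕ.z≤n
Σ-mono (suc n) h = ℕP.+-mono-≤ (h 0) (Σ-mono n (h ∘ suc))

Σ-1 : ∀ {f} n → (∀ i → i ℕ.< n → f i ≡ 1) → Σ f n ≡ n
Σ-1 zero    h = refl
Σ-1 (suc n) h = cong₂ ℕ._+_ (h 0 ℕ.z<s) (Σ-1 n (λ i → h (suc i) ∘ ℕ.s<s))

Σ-pos : ∀ f n → + Σ f n ≡ ℤSum.Σ (+_ ∘ f) n
Σ-pos f zero    = refl
Σ-pos f (suc n) = cong (ℤ._+_ (+ f 0)) (Σ-pos (f ∘ suc) n)

sum-applyUpTo : ∀ f n → sum (applyUpTo f n) ≡ Σ f n
sum-applyUpTo f zero    = refl
sum-applyUpTo f (suc n) = cong (f 0 ℕ.+_) (sum-applyUpTo (f ∘ suc) n)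

module _ (g : ℤ → ℕ) (n : ℕ) (g-periodic : ∀ z → g (z + + n) ≡ g z) where

  private
    window : ℤ → ℕ
    window z = Σ (λ i → g (z + + i)) n

    window-suc : ∀ z → window (z + + 1) ≡ window z
    window-suc z = ℕP.+-cancelˡ-≡ (g (z + + 0)) _ _ (begin
      g (z + + 0) ℕ.+ window (z + + 1)              ≡⟨ cong (g (z + + 0) ℕ.+_)
          (Σ-cong n (λ i _ → cong g (ℤP.+-assoc z (+ 1) (+ i)))) ⟩
      Σ (λ i → g (z + + i)) (suc n)                 ≡⟨ Σ-last (λ i → g (z + + i)) n ⟩
      window z ℕ.+ g (z + + n)                      ≡⟨ cong (window z ℕ.+_)
          (trans (g-periodic z) (cong g (sym (ℤP.+-identityʳ z)))) ⟩
      window z ℕ.+ g (z + + 0)                      ≡⟨ ℕP.+-comm (window z) _ ⟩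
      g (z + + 0) ℕ.+ window z ∎)
      where open ≡-Reasoning

    window-from-0 : ∀ z → window z ≡ window (+ 0)
    window-from-0 (+ zero)     = refl
    window-from-0 (+ suc k)    = trans (cong (window ∘ +_) (ℕP.+-comm 1 k))
        (trans (window-suc (+ k)) (window-from-0 (+ k)))
    window-from-0 -[1+ zero ]  = sym (window-suc -[1+ 0 ])
    window-from-0 -[1+ suc k ] = trans (sym (window-suc -[1+ suc k ])) (window-from-0 -[1+ k ])

  -- Sliding the window by one drops `g z` and gains `g (z + n)`, which are equal. So every window
  -- has the sum of the window at 0.
  Σ-period : ∀ y z → Σ (λ i → g (y + + i)) n ≡ Σ (λ i → g (z + + i)) n
  Σ-period y z = trans (window-from-0 y) (sym (window-from-0 z))

-- Indicators of decidable propositions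

ind : {P : Set} → Dec P → ℕ
ind (yes _) = 1
ind (no  _) = 0

ind-yes : {P : Set} (P? : Dec P) → P → ind P? ≡ 1
ind-yes (yes _) _ = refl
ind-yes (no ¬p) p = contradiction p ¬p

ind-no : {P : Set} (P? : Dec P) → ¬ P → ind P? ≡ 0
ind-no (yes p) ¬p = contradiction p ¬p
ind-no (no _)  _  = refl

ind-cong : {P Q : Set} (P? : Dec P) (Q? : Dec Q) → (P → Q) → (Q → P) → ind P? ≡ ind Q?
ind-cong (yes p) Q? f g = sym (ind-yes Q? (f p))
ind-cong (no ¬p) Q? f g = sym (ind-no Q? (¬p ∘ g))

ind≤1 : {P : Set} (P? : Dec P) → ind P? ℕ.≤ 1
ind≤1 (yes _) = ℕP.≤-refl
ind≤1 (no _)  = ℕ.z≤n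

length-filter : {A : Set} {P : A → Set} (P? : ∀ x → Dec (P x)) (f : ℕ → A) (n : ℕ) →
                length (filter P? (applyUpTo f n)) ≡ Σ (λ i → ind (P? (f i))) n
length-filter P? f zero = refl
length-filter P? f (suc n) with P? (f 0)
... | yes _ = cong suc (length-filter P? (f ∘ suc) n)
... | no  _ = length-filter P? (f ∘ suc) n

Σ-only-0 : ∀ {f} n .{{_ : NonZero n}} → (∀ i → 0 ℕ.< i → i ℕ.< n → f i ≡ 0) → Σ f n ≡ f 0
Σ-only-0 {f} (suc n) h = trans (cong (f 0 ℕ.+_) (Σ-ε n (λ i i<n → h (suc i) ℕ.z<s (ℕ.s<s i<n))))
    (ℕP.+-identityʳ (f 0))

-- Periodic maps and inversions within one window

module Periodic (n : ℕ) (ω : ℤ → ℤ) (periodic : ∀ i → ω (i + + n) ≡ ω i + + n) where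

  ω-+ℕ : ∀ z k → ω (z + + k * + n) ≡ ω z + + k * + n
  ω-+ℕ z zero  = trans (cong ω (ℤP.+-identityʳ z)) (sym (ℤP.+-identityʳ (ω z)))
  ω-+ℕ z (suc k) = begin
    ω (z + + suc k * + n)       ≡⟨ cong ω (split z (+ k) (+ n)) ⟩
    ω ((z + + k * + n) + + n)   ≡⟨ periodic _ ⟩
    ω (z + + k * + n) + + n     ≡⟨ cong (_+ + n) (ω-+ℕ z k) ⟩
    (ω z + + k * + n) + + n     ≡⟨ split (ω z) (+ k) (+ n) ⟨
    ω z + + suc k * + n ∎
    where
    open ≡-Reasoning
    split : ∀ z k n → z + (+ 1 + k) * n ≡ (z + k * n) + n
    split = solve-∀

  ω-+ : ∀ z q → ω (z + q * + n) ≡ ω z + q * + n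
  ω-+ z (+ k) = ω-+ℕ z k
  ω-+ z -[1+ k ] = begin
    ω y                                          ≡⟨ cancel (ω y) (+ suc k) (+ n) ⟨
    (ω y + + suc k * + n) + - + suc k * + n      ≡⟨ cong (_+ - + suc k * + n) (ω-+ℕ y (suc k)) ⟨
    ω (y + + suc k * + n) + - + suc k * + n      ≡⟨ cong (λ x → ω x + - + suc k * + n) (cancel′ z (+ suc k) (+ n)) ⟩
    ω z + - + suc k * + n ∎
    where
    open ≡-Reasoning
    y = z + -[1+ k ] * + n
    cancel : ∀ z k n → (z + k * n) + - k * n ≡ z
    cancel = solve-∀
    cancel′ : ∀ z k n → (z + - k * n) + k * n ≡ z
    cancel′ = solve-∀

  ω-- : ∀ z → ω (z - + n) ≡ ω z - + n
  ω-- z = begin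
    ω (z - + n)             ≡⟨ cong ω (neg z (+ n)) ⟩
    ω (z + - + 1 * + n)     ≡⟨ ω-+ z (- + 1) ⟩
    ω z + - + 1 * + n       ≡⟨ neg (ω z) (+ n) ⟨
    ω z - + n ∎
    where
    open ≡-Reasoning
    neg : ∀ z n → z - n ≡ z + - + 1 * n
    neg = solve-∀

-- Translating a pair (a , b) with ω b ≡ k (mod n) so that ω b = k turns the Pak–Stanley label
-- into a count over the single window before b.
PS-window : ∀ n p .{{_ : NonZero n}} {ω : ℤ → ℤ} → (∀ {x y} → ω x ≡ ω y → x ≡ y) →
            (∀ i → ω (i + + n) ≡ ω i + + n) → ∀ b k → ω b ≡ + k →
            PS n p ω k ≡ Σ (λ d → ind (ω b ℤ.<? ω (b - + suc d))) (p ∸ 1)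
PS-window n p {ω} ω-injective periodic b k ωb≡k = begin
  PS n p ω k
    ≡⟨ trans (cong sum (LP.map-applyUpTo suc _ n)) (sum-applyUpTo _ n) ⟩
  Σ _ n
    ≡⟨ Σ-cong n (λ a _ → length-filter _ (λ d → suc a ℕ.+ suc d) (p ∸ 1)) ⟩
  Σ (λ a → Σ (λ d → inversion d (+ 1 + + a)) (p ∸ 1)) n
    ≡⟨ Σ-comm (λ a d → inversion d (+ 1 + + a)) n (p ∸ 1) ⟩
  Σ (λ d → Σ (λ a → inversion d (+ 1 + + a)) n) (p ∸ 1)
    -- For a fixed distance `suc d` the first index may run over any n consecutive integers.
    -- Starting at `b - suc d` makes `b` the first of the second indices.
    ≡⟨ Σ-cong (p ∸ 1) (λ d _ → Σ-period (inversion d) n (inversion-periodic d) (+ 1) (b - + suc d)) ⟩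
  Σ (λ d → Σ (λ a → inversion d (b - + suc d + + a)) n) (p ∸ 1)
    ≡⟨ Σ-cong (p ∸ 1) (λ d _ → trans (Σ-only-0 n (only d)) (at-0 d)) ⟩
  Σ (λ d → ind (ω b ℤ.<? ω (b - + suc d))) (p ∸ 1) ∎
  where
  open ≡-Reasoning
  open Periodic n ω periodic

  inversion : ℕ → ℤ → ℕ
  inversion d z = ind ((ω (z + + suc d) ℤ.<? ω z) ×-dec (ω (z + + suc d) %ℕ n ℕ.≟ k % n))

  ω-shift : ∀ z d → ω (z + + n + d) ≡ ω (z + d) + + n
  ω-shift z d = trans (cong ω (((∀ z n d → z + n + d ≡ z + d + n) ∋ solve-∀) z (+ n) d)) (periodic (z + d))

  %-shift : ∀ z → (z + + n) %ℕ n ≡ z %ℕ n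
  %-shift z = trans (cong (λ y → (z + y) %ℕ n) (sym (ℤP.*-identityˡ (+ n)))) (%ℕ-+ n z (+ 1))

  inversion-periodic : ∀ d z → inversion d (z + + n) ≡ inversion d z
  inversion-periodic d z = ind-cong _ _
    (λ (lt , eq) → +-cancelʳ-< (+ n) (subst₂ _<_ (ω-shift z (+ suc d)) (periodic z) lt)
                 , trans (sym (%-shift (ω (z + + suc d)))) (trans (cong (_%ℕ n) (sym (ω-shift z (+ suc d)))) eq))
    (λ (lt , eq) → subst₂ _<_ (sym (ω-shift z (+ suc d))) (sym (periodic z)) (ℤP.+-monoˡ-< (+ n) lt)
                 , trans (cong (_%ℕ n) (ω-shift z (+ suc d))) (trans (%-shift (ω (z + + suc d))) eq))

  back : ∀ d a → b - + suc d + a + + suc d ≡ b + a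
  back d a = ((∀ b d a → b - d + a + d ≡ b + a) ∋ solve-∀) b (+ suc d) a

  -- If `ω (b + a)` and `ω b` were congruent modulo n, periodicity and injectivity would make `a` a
  -- multiple of n.
  only : ∀ d a → 0 ℕ.< a → a ℕ.< n → inversion d (b - + suc d + + a) ≡ 0
  only d a 0<a a<n = ind-no _ λ (_ , eq) →
    let q , eq′ = %ℕ-cong⇒ n (ω (b + + a)) (ω b) (trans (cong (λ z → ω z %ℕ n) (sym (back d (+ a))))
          (trans eq (cong (_%ℕ n) (sym ωb≡k))))
        a≡ = ω-injective (trans eq′ (sym (ω-+ b q)))
    in ℕP.<⇒≢ 0<a (sym (proj₁ (residue-unique n (+ 0) q a<n (ℕP.<-trans 0<a a<n)
         (≡-by a≡ (((∀ b a q n → (b + a) - (b + q * n) ≡ (a + + 0 * n) - (+ 0 + q * n)) ∋ solve-∀) b (+ a) q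
             (+ n))))))

  at-0 : ∀ d → inversion d (b - + suc d + + 0) ≡ ind (ω b ℤ.<? ω (b - + suc d))
  at-0 d = ind-cong _ _
    (λ (lt , _) → subst₂ _<_ b≡ b-d≡ lt)
    (λ lt → subst₂ _<_ (sym b≡) (sym b-d≡) lt , cong (_%ℕ n) (trans b≡ ωb≡k))
    where
    b≡ = cong ω (trans (back d (+ 0)) (ℤP.+-identityʳ b))
    b-d≡ = cong ω (ℤP.+-identityʳ (b - + suc d))

-- Lattice paths

AnnotatedStep : Set
AnnotatedStep = (ℕ × ℕ) × Step

vertex-bounds : ∀ i j s {u v} → (u , v) ∈ vertices i j s →
                i ℕ.≤ u × j ℕ.≤ v × u ℕ.≤ i ℕ.+ countE s × v ℕ.≤ j ℕ.+ countN s
vertex-bounds i j [] (here refl) = ℕP.≤-refl , ℕP.≤-refl , ℕP.m≤m+n i 0 , ℕP.m≤m+n j 0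
vertex-bounds i j (N ∷ s) (here refl) = ℕP.≤-refl , ℕP.≤-refl , ℕP.m≤m+n i _ , ℕP.m≤m+n j _
vertex-bounds i j (E ∷ s) (here refl) = ℕP.≤-refl , ℕP.≤-refl , ℕP.m≤m+n i _ , ℕP.m≤m+n j _
vertex-bounds i j (N ∷ s) {u} {v} (there q) =
  let a , b , c , d = vertex-bounds i (suc j) s q in
  a , ℕP.<⇒≤ b , c , subst (v ℕ.≤_) (sym (ℕP.+-suc j _)) d
vertex-bounds i j (E ∷ s) {u} {v} (there q) =
  let a , b , c , d = vertex-bounds (suc i) j s q in
  ℕP.<⇒≤ a , b , subst (u ℕ.≤_) (sym (ℕP.+-suc i _)) c , d

first∈vertices : ∀ i j s → (i , j) ∈ vertices i j s
first∈vertices i j []      = here refl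
first∈vertices i j (N ∷ s) = here refl
first∈vertices i j (E ∷ s) = here refl

start∈vertices : ∀ i j s {P c} → (P , c) ∈ annotate i j s → P ∈ vertices i j s
start∈vertices i j (N ∷ s) (here refl) = here refl
start∈vertices i j (E ∷ s) (here refl) = here refl
start∈vertices i j (N ∷ s) (there q)   = there (start∈vertices i (suc j) s q)
start∈vertices i j (E ∷ s) (there q)   = there (start∈vertices (suc i) j s q)

E-end∈vertices : ∀ i j s {u v} → ((u , v) , E) ∈ annotate i j s → (suc u , v) ∈ vertices i j s
E-end∈vertices i j (E ∷ s) (here refl) = there (first∈vertices (suc i) j s)
E-end∈vertices i j (N ∷ s) (there q)   = there (E-end∈vertices i (suc j) s q)
E-end∈vertices i j (E ∷ s) (there q)   = there (E-end∈vertices (suc i) j s q)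

N-end∈vertices : ∀ i j s {u v} → ((u , v) , N) ∈ annotate i j s → (u , suc v) ∈ vertices i j s
N-end∈vertices i j (N ∷ s) (here refl) = there (first∈vertices i (suc j) s)
N-end∈vertices i j (N ∷ s) (there q)   = there (N-end∈vertices i (suc j) s q)
N-end∈vertices i j (E ∷ s) (there q)   = there (N-end∈vertices (suc i) j s q)

E-step-in-column : ∀ i j s {u} → i ℕ.≤ u → u ℕ.< i ℕ.+ countE s → ∃ λ v → ((u , v) , E) ∈ annotate i j s
E-step-in-column i j [] i≤u u<i = contradiction i≤u (ℕP.<⇒≱ (subst (_ ℕ.<_) (ℕP.+-identityʳ i) u<i))
E-step-in-column i j (N ∷ s) i≤u u< = let v , q = E-step-in-column i (suc j) s i≤u u< in v , there q
E-step-in-column i j (E ∷ s) {u} i≤u u< with i ℕ.≟ u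
... | yes refl = j , here refl
... | no  i≢u  = let v , q = E-step-in-column (suc i) j s (ℕP.≤∧≢⇒< i≤u i≢u)
                       (subst (u ℕ.<_) (ℕP.+-suc i _) u<) in v , there q

-- The east step that leaves column `u` comes after the north step, so it is strictly higher: the
-- square to the right of a north step lies below the path.
E-step-above-N : ∀ i j s {u v} → ((u , v) , N) ∈ annotate i j s → u ℕ.< i ℕ.+ countE s →
                 ∃ λ v′ → v ℕ.< v′ × ((u , v′) , E) ∈ annotate i j s
E-step-above-N i j (N ∷ s) (here refl) u< =
  let v′ , q = E-step-in-column i (suc j) s ℕP.≤-refl u<
  in v′ , proj₁ (proj₂ (vertex-bounds i (suc j) s (start∈vertices i (suc j) s q))) , there q
E-step-above-N i j (N ∷ s) (there q) u< = let v′ , lt , q′ = E-step-above-N i (suc j) s q u< in v′ , lt , there q′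
E-step-above-N i j (E ∷ s) {u} (there q) u< =
  let v′ , lt , q′ = E-step-above-N (suc i) j s q (subst (u ℕ.<_) (ℕP.+-suc i _) u<) in v′ , lt , there q′

-- A vertex visited before the east step is weakly to the left of its start, and one visited after
-- it is weakly higher.
not-below-E : ∀ i j s {u v u′ v′} → ((u , v) , E) ∈ annotate i j s → (u′ , v′) ∈ vertices i j s →
              u′ ℕ.≤ u ⊎ v ℕ.≤ v′
not-below-E i j s@(E ∷ _) (here refl) r = inj₂ (proj₁ (proj₂ (vertex-bounds i j s r)))
not-below-E i j s@(N ∷ _) q@(there _) (here refl) = inj₁ (proj₁ (vertex-bounds i j s (start∈vertices i j s q)))
not-below-E i j s@(E ∷ _) q@(there _) (here refl) = inj₁ (proj₁ (vertex-bounds i j s (start∈vertices i j s q)))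
not-below-E i j (N ∷ s) (there q) (there r) = not-below-E i (suc j) s q r
not-below-E i j (E ∷ s) (there q) (there r) = not-below-E (suc i) j s q r

-- "Before a b" says that the end of step a is weakly south-west of the start of step b.
Before : AnnotatedStep → AnnotatedStep → Set
Before ((u , v) , N) ((u′ , v′) , _) = u ℕ.≤ u′ × v ℕ.< v′
Before ((u , v) , E) ((u′ , v′) , _) = u ℕ.< u′ × v ℕ.≤ v′

annotate-ordered : ∀ i j s → AllPairs Before (annotate i j s)
annotate-ordered i j [] = []
annotate-ordered i j (N ∷ s) =
  All.tabulate (λ q → let a , b , _ = vertex-bounds i (suc j) s (start∈vertices i (suc j) s q) in a , b)
  ∷ annotate-ordered i (suc j) s
annotate-ordered i j (E ∷ s) =
  All.tabulate (λ q → let a , b , _ = vertex-bounds (suc i) j s (start∈vertices (suc i) j s q) in a , b)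
  ∷ annotate-ordered (suc i) j s

AllPairs-refine : {A : Set} {P : A → Set} {R S : A → A → Set} {xs : List A} →
                  (∀ {a b} → P a → P b → R a b → S a b) → All P xs → AllPairs R xs → AllPairs S xs
AllPairs-refine f [] [] = []
AllPairs-refine f (p ∷ ps) (r ∷ rs) = All.map (λ (pb , rab) → f p pb rab) (All.zip (ps , r)) ∷ AllPairs-refine f ps rs

-- Labels of lattice points and of squares below a path

label≡ : ∀ n p i j → label n p i j ≡ + j * + p - + i * + n
label≡ n p i j = cong₂ _-_ (ℤP.pos-* j p) (ℤP.pos-* i n)

label-suc-E : ∀ n p i j → label n p (suc i) j ≡ label n p i j - + n
label-suc-E n p i j = trans (label≡ n p (suc i) j) (trans
  (((∀ i j n p → j * p - (+ 1 + i) * n ≡ j * p - i * n - n) ∋ solve-∀) (+ i) (+ j) (+ n) (+ p))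
  (cong (_- + n) (sym (label≡ n p i j))))

label-suc-N : ∀ n p i j → label n p i (suc j) ≡ label n p i j + + p
label-suc-N n p i j = trans (label≡ n p i (suc j)) (trans
  (((∀ i j n p → (+ 1 + j) * p - i * n ≡ j * p - i * n + p) ∋ solve-∀) (+ i) (+ j) (+ n) (+ p))
  (cong (_+ + p) (sym (label≡ n p i j))))

0≤label : ∀ {n p i j} → i ℕ.* n ℕ.≤ j ℕ.* p → + 0 ≤ label n p i j
0≤label le = ℤP.i≤j⇒0≤j-i (ℤ.+≤+ le)

0≤label⇒ : ∀ {n p i j} → + 0 ≤ label n p i j → i ℕ.* n ℕ.≤ j ℕ.* p
0≤label⇒ le = ℤP.drop‿+≤+ (ℤP.0≤i-j⇒j≤i le)

module _ {n p : ℕ} .{{_ : NonZero n}} .{{_ : NonZero p}} (coprime : Coprime n p) where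

  private
    -- Cancelling `k * p` shows that n divides `(v - k) * p`, hence `v - k` by coprimality. Inside
    -- the box this difference is 0 or n, and it is n only for the corners `(0 , 0)` and `(p , n)`.
    lattice : ∀ {u v u′ k} → k ℕ.≤ v → v ℕ.≤ n → u ℕ.≤ p → v ℕ.* p ℕ.+ u′ ℕ.* n ≡ k ℕ.* p ℕ.+ u ℕ.* n →
              (u ≡ u′ × v ≡ k) ⊎ (u′ ≡ 0 × k ≡ 0 × u ≡ p × v ≡ n)
    lattice {u} {v} {u′} {k} k≤v v≤n u≤p eq with Coprimality.coprime-divisor coprime n∣
      where
      eq′ : (v ∸ k) ℕ.* p ℕ.+ u′ ℕ.* n ≡ u ℕ.* n
      eq′ = ℕP.+-cancelˡ-≡ (k ℕ.* p) _ _ (trans (sym (ℕP.+-assoc (k ℕ.* p) ((v ∸ k) ℕ.* p) (u′ ℕ.* n)))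
        (trans (cong (ℕ._+ u′ ℕ.* n) (trans (sym (ℕP.*-distribʳ-+ p k (v ∸ k))) (cong (ℕ._* p) (ℕP.m+[n∸m]≡n k≤v))))
            eq))
      n∣ : n Div.∣ p ℕ.* (v ∸ k)
      n∣ = Div.∣m+n∣m⇒∣n (Div.∣-trans (Div.divides u refl)
          (Div.∣-reflexive (trans (sym eq′) (trans (ℕP.+-comm _ (u′ ℕ.* n))
              (cong (u′ ℕ.* n ℕ.+_) (ℕP.*-comm (v ∸ k) p)))))) (Div.divides u′ refl)
    ... | Div.divides zero v∸k≡0 = inj₁ (ℕP.*-cancelʳ-≡ u u′ n
        (sym (ℕP.+-cancelˡ-≡ (k ℕ.* p) _ _ (trans (cong (λ w → w ℕ.* p ℕ.+ u′ ℕ.* n) (sym v≡k)) eq))) , v≡k)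
      where
      v≡k : v ≡ k
      v≡k = ℕP.≤-antisym (ℕP.m∸n≡0⇒m≤n v∸k≡0) k≤v
    ... | Div.divides (suc q) v∸k≡ = inj₂ (u′≡0 , k≡0 , u≡p , v≡n)
      where
      n≤v∸k : n ℕ.≤ v ∸ k
      n≤v∸k = subst (n ℕ.≤_) (sym v∸k≡) (ℕP.m≤m+n n (q ℕ.* n))
      v≡n : v ≡ n
      v≡n = ℕP.≤-antisym v≤n (ℕP.≤-trans n≤v∸k (ℕP.m∸n≤m v k))
      k≡0 : k ≡ 0
      k≡0 = ℕP.n≤0⇒n≡0 (ℕP.+-cancelʳ-≤ n k 0 (ℕP.≤-trans (ℕP.+-monoʳ-≤ k n≤v∸k)
          (ℕP.≤-reflexive (trans (ℕP.m+[n∸m]≡n k≤v) v≡n))))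
      eq″ : p ℕ.+ u′ ≡ u
      eq″ = ℕP.*-cancelʳ-≡ (p ℕ.+ u′) u n (trans (ℕP.*-distribʳ-+ n p u′)
          (trans (cong (ℕ._+ u′ ℕ.* n) (trans (ℕP.*-comm p n) (cong (ℕ._* p) (sym v≡n))))
              (trans eq (cong (λ w → w ℕ.* p ℕ.+ u ℕ.* n) k≡0))))
      u′≡0 : u′ ≡ 0
      u′≡0 = ℕP.n≤0⇒n≡0 (ℕP.+-cancelˡ-≤ p u′ 0 (ℕP.≤-trans (ℕP.≤-reflexive eq″) (ℕP.≤-trans u≤p (ℕP.m≤m+n p 0))))
      u≡p : u ≡ p
      u≡p = trans (sym eq″) (trans (cong (p ℕ.+_) u′≡0) (ℕP.+-identityʳ p))

    unlabel : ∀ u v u′ v′ → label n p u v ≡ label n p u′ v′ → v ℕ.* p ℕ.+ u′ ℕ.* n ≡ v′ ℕ.* p ℕ.+ u ℕ.* n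
    unlabel u v u′ v′ eq = ℤP.+-injective (≡-by eq
      (((∀ a b c d → (a - b) - (c - d) ≡ (a + d) - (c + b)) ∋ solve-∀) (+ (v ℕ.* p)) (+ (u ℕ.* n)) (+ (v′ ℕ.* p))
          (+ (u′ ℕ.* n))))

  label-injective : ∀ {u v u′ k} → v ℕ.≤ n → u ℕ.≤ p → k ℕ.≤ n → u′ ℕ.≤ p → label n p u v ≡ label n p u′ k →
                    (u ≡ u′ × v ≡ k) ⊎ (u′ ≡ 0 × k ≡ 0 × u ≡ p × v ≡ n) ⊎ (u ≡ 0 × v ≡ 0 × u′ ≡ p × k ≡ n)
  label-injective {u} {v} {u′} {k} v≤n u≤p k≤n u′≤p eq with ℕP.≤-total k v
  ... | inj₁ k≤v with lattice k≤v v≤n u≤p (unlabel u v u′ k eq)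
  ...   | inj₁ same = inj₁ same
  ...   | inj₂ ends = inj₂ (inj₁ ends)
  label-injective {u} {v} {u′} {k} v≤n u≤p k≤n u′≤p eq | inj₂ v≤k with lattice v≤k k≤n u′≤p
      (unlabel u′ k u v (sym eq))
  ...   | inj₁ (a , b) = inj₁ (sym a , sym b)
  ...   | inj₂ ends = inj₂ (inj₂ ends)

  -- The bottom-right corner `(suc u′ , k)` of a square with `k < n` is neither of the two points
  -- that share the label 0.
  label-injective-< : ∀ {u v u′ k} → v ℕ.≤ n → u ℕ.≤ p → k ℕ.< n → suc u′ ℕ.≤ p →
                      label n p u v ≡ label n p (suc u′) k → u ≡ suc u′ × v ≡ k
  label-injective-< v≤n u≤p k<n u′≤p eq with label-injective v≤n u≤p (ℕP.<⇒≤ k<n) u′≤p eq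
  ... | inj₁ same = same
  ... | inj₂ (inj₁ (() , _))
  ... | inj₂ (inj₂ (_ , _ , _ , k≡n)) = contradiction k≡n (ℕP.<⇒≢ k<n)

module _ {n p : ℕ} where

  ∈H⁻ : ∀ x {h} → h ∈ H n p x →
        ∃ λ u → ∃ λ v → ∃ λ k → ((u , v) , E) ∈ annotate 0 0 x × k ℕ.< v × + h ≡ label n p (suc u) k × 0 ℕ.< h
  ∈H⁻ x h∈H with find (∈-concatMap⁻ _ {xs = annotate 0 0 x} h∈H)
  ... | ((u , v) , N) , q , ()
  ... | ((u , v) , E) , q , h∈ with ∈-map⁻ ∣_∣ h∈
  ...   | z , z∈ , refl with ∈-filter⁻ (+ 0 ℤ.<?_) {xs = applyUpTo (label n p (suc u)) v} z∈
  ...     | z∈′ , 0<z with ∈-applyUpTo⁻ (label n p (suc u)) z∈′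
  ...       | k , k<v , refl = u , v , k , q , k<v , ∣z∣≡ , ℤP.drop‿+<+ (subst (+ 0 <_) (sym ∣z∣≡) 0<z)
    where ∣z∣≡ = ℤP.0≤i⇒+∣i∣≡i (ℤP.<⇒≤ 0<z)

  ∈H⁺ : ∀ x {h u v k} → ((u , v) , E) ∈ annotate 0 0 x → k ℕ.< v → + h ≡ label n p (suc u) k → 0 ℕ.< h →
        h ∈ H n p x
  ∈H⁺ x {h} {u} {v} q k<v eq 0<h = ∈-concatMap⁺ _ (lose q
    (subst (_∈ _) (cong ∣_∣ (sym eq)) (∈-map⁺ ∣_∣ (∈-filter⁺ (+ 0 ℤ.<?_) (∈-applyUpTo⁺ (label n p (suc u)) k<v)
        (subst (+ 0 <_) eq (ℤ.+<+ 0<h))))))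

module DyckPath {n p : ℕ} .{{_ : NonZero n}} .{{_ : NonZero p}} (coprime : Coprime n p) {x : Path}
    (dyck : IsDyck n p x) where

  countN≡ = proj₁ dyck
  countE≡ = proj₁ (proj₂ dyck)

  vertex-in-box : ∀ {u v} → (u , v) ∈ vertices 0 0 x → u ℕ.≤ p × v ℕ.≤ n
  vertex-in-box q = let _ , _ , u≤ , v≤ = vertex-bounds 0 0 x q in
    subst (_ ℕ.≤_) countE≡ u≤ , subst (_ ℕ.≤_) countN≡ v≤

  above-diagonal : ∀ {u v} → (u , v) ∈ vertices 0 0 x → u ℕ.* n ℕ.≤ v ℕ.* p
  above-diagonal = All.lookup (proj₂ (proj₂ dyck))

  E-in-box : ∀ {u v} → ((u , v) , E) ∈ annotate 0 0 x → u ℕ.< p × v ℕ.≤ n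
  E-in-box q = vertex-in-box (E-end∈vertices 0 0 x q)

  N-in-box : ∀ {u v} → ((u , v) , N) ∈ annotate 0 0 x → u ℕ.< p × v ℕ.< n
  N-in-box {u} {v} q = u<p , v<n
    where
    v<n = proj₂ (vertex-in-box (N-end∈vertices 0 0 x q))
    u<p : u ℕ.< p
    u<p = ℕP.*-cancelʳ-< n u p (ℕP.≤-<-trans (above-diagonal (start∈vertices 0 0 x q))
      (subst (v ℕ.* p ℕ.<_) (ℕP.*-comm n p) (ℕP.*-monoˡ-< p v<n)))

  private
    labelOf : AnnotatedStep → ℤ
    labelOf ((u , v) , _) = label n p u v

    -- Equal labels mean equal points, which `Before` forbids, or the two corners of the box; no
    -- step precedes one starting at `(0 , 0)`, and none starts at `(p , n)`.
    distinct : ∀ {a b} → a ∈ annotate 0 0 x → b ∈ annotate 0 0 x → Before a b → labelOf a ≢ labelOf b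
    distinct {(u , v) , c} {(u′ , v′) , c′} q q′ bef eq
      with vertex-in-box (start∈vertices 0 0 x q) | vertex-in-box (start∈vertices 0 0 x q′)
    ... | u≤p , v≤n | u′≤p , v′≤n with label-injective coprime v≤n u≤p v′≤n u′≤p eq
    ...   | inj₁ (refl , refl) = irreflexive c bef
      where
      irreflexive : ∀ c → ¬ Before ((u , v) , c) ((u , v) , c′)
      irreflexive N (_ , lt) = ℕP.<-irrefl refl lt
      irreflexive E (lt , _) = ℕP.<-irrefl refl lt
    ...   | inj₂ (inj₁ (refl , refl , _)) = nothing-before c bef
      where
      nothing-before : ∀ c → ¬ Before ((u , v) , c) ((0 , 0) , c′)
      nothing-before N (_ , ())
      nothing-before E (() , _)
    ...   | inj₂ (inj₂ (_ , _ , refl , refl)) = last c′ q′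
      where
      last : ∀ c → ¬ ((p , n) , c) ∈ annotate 0 0 x
      last N q = ℕP.<-irrefl refl (proj₁ (N-in-box q))
      last E q = ℕP.<-irrefl refl (proj₁ (E-in-box q))

  labels-distinct : AllPairs (λ a b → labelOf a ≢ labelOf b) (annotate 0 0 x)
  labels-distinct = AllPairs-refine distinct (All.tabulate id) (annotate-ordered 0 0 x)

  H-positive : ∀ {h} → h ∈ H n p x → 0 ℕ.< h
  H-positive h∈H = let _ , _ , _ , _ , _ , _ , 0<h = ∈H⁻ x h∈H in 0<h

  -- By injectivity of labels the corner of the square would be the vertex itself, but no vertex of
  -- the path lies strictly under one of its east steps.
  vertex∉H : ∀ {u v} → (u , v) ∈ vertices 0 0 x → ∣ label n p u v ∣ ∉ H n p x
  vertex∉H {u} {v} q h∈H with ∈H⁻ x h∈H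
  ... | u′ , v′ , k , E∈ , k<v′ , eq , _ with E-in-box E∈ | vertex-in-box q
  ...   | u′<p , v′≤n | u≤p , v≤n with label-injective-< coprime v≤n u≤p (ℕP.<-≤-trans k<v′ v′≤n) u′<p
      (trans (sym (ℤP.0≤i⇒+∣i∣≡i (0≤label {n} {p} {u} {v} (above-diagonal q)))) eq)
  ...     | refl , refl with not-below-E 0 0 x E∈ q
  ...       | inj₁ u′<u′ = ℕP.<-irrefl refl u′<u′
  ...       | inj₂ v′≤k  = ℕP.<⇒≱ k<v′ v′≤k

  -- 0 is the label of the origin, and labels separate these points. So a square below x whose label
  -- is nonnegative already counts in `H`.
  label≢0 : ∀ {u k} → u ℕ.< p → k ℕ.< n → label n p (suc u) k ≢ + 0
  label≢0 {u} {k} u<p k<n eq with label-injective-< coprime {0} {0} ℕ.z≤n ℕ.z≤n k<n u<p (sym eq)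
  ... | () , _

  below-E∈H : ∀ {u v k} → ((u , v) , E) ∈ annotate 0 0 x → k ℕ.< v → + 0 ≤ label n p (suc u) k →
              ∣ label n p (suc u) k ∣ ∈ H n p x
  below-E∈H {u} {v} {k} q k<v 0≤l with E-in-box q
  ... | u<p , v≤n = ∈H⁺ x q k<v eq (ℕP.≤∧≢⇒< ℕ.z≤n (λ 0≡ → label≢0 u<p (ℕP.<-≤-trans k<v v≤n)
      (trans (sym eq) (cong +_ (sym 0≡)))))
    where eq = ℤP.0≤i⇒+∣i∣≡i 0≤l

  private
    -- A named copy of the local function in the definition of `H`; `column≗` identifies the two.
    column : AnnotatedStep → List ℕ
    column (_ , N) = []
    column ((u , v) , E) = map ∣_∣ (filter (+ 0 ℤ.<?_) (applyUpTo (label n p (suc u)) v))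

    ∈column⁻ : ∀ u v {h} → h ∈ column ((u , v) , E) → ∃ λ k → k ℕ.< v × + h ≡ label n p (suc u) k
    ∈column⁻ u v h∈ with ∈-map⁻ ∣_∣ h∈
    ... | z , z∈ , refl with ∈-filter⁻ (+ 0 ℤ.<?_) {xs = applyUpTo (label n p (suc u)) v} z∈
    ...   | z∈′ , 0<z with ∈-applyUpTo⁻ (label n p (suc u)) z∈′
    ...     | k , k<v , refl = k , k<v , ℤP.0≤i⇒+∣i∣≡i (ℤP.<⇒≤ 0<z)

    column-unique : ∀ {a} → a ∈ annotate 0 0 x → Unique (column a)
    column-unique {_ , N} _ = []
    column-unique {(u , v) , E} q = AllPairsP.map⁺ (AllPairs-refine
      (λ {y} {z} 0<y 0<z y≢z eq → y≢z (trans (sym (ℤP.0≤i⇒+∣i∣≡i (ℤP.<⇒≤ 0<y)))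
          (trans (cong +_ eq) (ℤP.0≤i⇒+∣i∣≡i (ℤP.<⇒≤ 0<z)))))
      (AllP.all-filter (+ 0 ℤ.<?_) (applyUpTo (label n p (suc u)) v))
      (UniqueP.filter⁺ (+ 0 ℤ.<?_) (UniqueP.applyUpTo⁺₁ (label n p (suc u)) v
        (λ i<j j<v eq → let u<p , v≤n = E-in-box q in
          ℕP.<⇒≢ i<j (proj₂ (label-injective-< coprime (ℕP.<⇒≤ (ℕP.<-≤-trans (ℕP.<-trans i<j j<v) v≤n)) u<p
              (ℕP.<-≤-trans j<v v≤n) u<p eq))))))

    columns-disjoint : ∀ {a b} → a ∈ annotate 0 0 x → b ∈ annotate 0 0 x → Before a b →
                       Disjoint (column a) (column b)
    columns-disjoint {_ , N} _ _ _ (() , _)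
    columns-disjoint {_ , E} {_ , N} _ _ _ (_ , ())
    columns-disjoint {(u , v) , E} {(u′ , v′) , E} q q′ (u<u′ , _) (h∈ , h∈′)
      with ∈column⁻ u v h∈ | ∈column⁻ u′ v′ h∈′ | E-in-box q | E-in-box q′
    ... | k , k<v , eq | k′ , k′<v′ , eq′ | u<p , v≤n | u′<p , v′≤n
      with label-injective-< coprime (ℕP.<⇒≤ (ℕP.<-≤-trans k<v v≤n)) u<p (ℕP.<-≤-trans k′<v′ v′≤n) u′<p
          (trans (sym eq) eq′)
    ...   | refl , _ = ℕP.<-irrefl refl u<u′

  H-unique : Unique (H n p x)
  H-unique = subst Unique (LP.concatMap-cong column≗ (annotate 0 0 x)) (UniqueP.concat⁺
    (AllP.map⁺ (All.tabulate column-unique))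
    (AllPairsP.map⁺ (AllPairs-refine columns-disjoint (All.tabulate id) (annotate-ordered 0 0 x))))
    where
    column≗ : ∀ a → column a ≡ _
    column≗ (_ , N) = refl
    column≗ (_ , E) = refl

  -- `P` stands for Δ: the three hypotheses say that it consists of the nonnegative integers whose
  -- absolute value is outside `H`.
  module Labels {P : ℤ → Set} (P⇒0≤ : ∀ {z} → P z → + 0 ≤ z) (P⇒∉H : ∀ {z} → P z → ∣ z ∣ ∉ H n p x)
                (∉H⇒P : ∀ {z} → + 0 ≤ z → ∣ z ∣ ∉ H n p x → P z) where

    vertex-P : ∀ {u v} → (u , v) ∈ vertices 0 0 x → P (label n p u v)
    vertex-P {u} {v} q = ∉H⇒P (0≤label {n} {p} {u} {v} (above-diagonal q)) (vertex∉H q)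

    -- `label - n` belongs to the square to the right of the north step, which is below the path.
    N-minimal : ∀ {u v} → ((u , v) , N) ∈ annotate 0 0 x → ¬ P (label n p u v - + n)
    N-minimal {u} {v} q Pl with E-step-above-N 0 0 x q (subst (u ℕ.<_) (sym countE≡) (proj₁ (N-in-box q)))
    ... | v′ , v<v′ , q′ = P⇒∉H Pl′ (below-E∈H q′ v<v′ (P⇒0≤ Pl′))
      where Pl′ = subst P (sym (label-suc-E n p u v)) Pl

    -- `label - n - p` belongs to the top square under the east step. At height 0 there is no such
    -- square, but an east step there would end below the diagonal.
    E-minimal : ∀ {u v} → ((u , v) , E) ∈ annotate 0 0 x → ¬ P (label n p u v - + n - + p)
    E-minimal {u} {zero} q _ = ℕ.≢-nonZero⁻¹ n (ℕP.m+n≡0⇒m≡0 n (ℕP.n≤0⇒n≡0 (above-diagonal (E-end∈vertices 0 0 x q))))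
    E-minimal {u} {suc v} q Pl = P⇒∉H Pl′ (below-E∈H q ℕP.≤-refl (P⇒0≤ Pl′))
      where Pl′ = subst P (trans (cong (λ l → l - + n - + p) (label-suc-N n p u v)) (trans
                    (((∀ l n p → l + p - n - p ≡ l - n) ∋ solve-∀) (label n p u v) (+ n) (+ p))
                    (sym (label-suc-E n p u v)))) Pl

-- Sorted lists

AllPairs-resp-↭ : {A : Set} {R : A → A → Set} → (∀ {a b} → R a b → R b a) →
                  ∀ {xs ys} → xs ↭ ys → AllPairs R xs → AllPairs R ys
AllPairs-resp-↭ {A} {R} R-sym p = ↭S.AllPairs-resp-↭ (setoid A) R-sym (resp₂ R) (↭⇒↭ₛ p)

increasing-bound : ∀ {b} x xs → AllPairs ℕ._<_ (x ∷ xs) → All (ℕ._< b) (x ∷ xs) → x ℕ.+ length (x ∷ xs) ℕ.≤ b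
increasing-bound {b} x [] _ (x<b ∷ _) = subst (ℕ._≤ b) (ℕP.+-comm 1 x) x<b
increasing-bound x (y ∷ ys) ((x<y ∷ _) ∷ inc) (_ ∷ ys<b) =
  ℕP.≤-trans (subst (ℕ._≤ y ℕ.+ length (y ∷ ys)) (sym (ℕP.+-suc x _)) (ℕP.+-monoˡ-≤ _ x<y))
      (increasing-bound y ys inc ys<b)

-- There is no room to spare: an increasing list that starts at `x` reaches at least
-- `x + length - 1`, which forces the first entry to be `m`.
increasing-interval : ∀ m xs → AllPairs ℕ._<_ xs → All (m ℕ.≤_) xs → All (ℕ._< m ℕ.+ length xs) xs →
                      xs ≡ applyUpTo (m ℕ.+_) (length xs)
increasing-interval m [] _ _ _ = refl
increasing-interval m (x ∷ xs) inc@(x< ∷ inc′) (m≤x ∷ m≤) xs<@(_ ∷ xs<′)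
  with ℕP.≤-antisym m≤x (ℕP.+-cancelʳ-≤ _ x m (increasing-bound x xs inc xs<))
... | refl = cong₂ _∷_ (sym (ℕP.+-identityʳ m)) (trans
  (increasing-interval (suc m) xs inc′ x< (subst (λ b → All (ℕ._< b) xs) (ℕP.+-suc m (length xs)) xs<′))
  (applyUpTo-cong (λ i → sym (ℕP.+-suc m i)) (length xs)))
  where
  applyUpTo-cong : ∀ {f g : ℕ → ℕ} → (∀ i → f i ≡ g i) → ∀ k → applyUpTo f k ≡ applyUpTo g k
  applyUpTo-cong h zero    = refl
  applyUpTo-cong h (suc k) = cong₂ _∷_ (h 0) (applyUpTo-cong (h ∘ suc) k)

LabelledStep : Set
LabelledStep = ℤ × Step

insertByLabel-↭ : ∀ a xs → insertByLabel a xs ↭ a ∷ xs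
insertByLabel-↭ a [] = ↭-refl
insertByLabel-↭ a (y ∷ ys) with proj₁ a ℤ.≤? proj₁ y
... | yes _ = ↭-refl
... | no  _ = ↭-trans (prep y (insertByLabel-↭ a ys)) (swap y a ↭-refl)

sortByLabel-↭ : ∀ xs → sortByLabel xs ↭ xs
sortByLabel-↭ [] = ↭-refl
sortByLabel-↭ (a ∷ xs) = ↭-trans (insertByLabel-↭ a (sortByLabel xs)) (prep a (sortByLabel-↭ xs))

insertByLabel-sorted : ∀ a {xs} → AllPairs (λ b c → proj₁ b ≤ proj₁ c) xs →
                       AllPairs (λ b c → proj₁ b ≤ proj₁ c) (insertByLabel a xs)
insertByLabel-sorted a [] = [] ∷ []
insertByLabel-sorted a {y ∷ ys} (y≤ ∷ sorted) with proj₁ a ℤ.≤? proj₁ y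
... | yes a≤y = (a≤y ∷ All.map (ℤP.≤-trans a≤y) y≤) ∷ y≤ ∷ sorted
... | no  a≰y = ↭P.All-resp-↭ (↭-sym (insertByLabel-↭ a ys))
    (ℤP.<⇒≤ (ℤP.≰⇒> a≰y) ∷ y≤) ∷ insertByLabel-sorted a sorted

sortByLabel-sorted : ∀ xs → AllPairs (λ b c → proj₁ b ≤ proj₁ c) (sortByLabel xs)
sortByLabel-sorted [] = []
sortByLabel-sorted (a ∷ xs) = insertByLabel-sorted a (sortByLabel-sorted xs)

sortByLabel-strict : ∀ {xs} → AllPairs (λ b c → proj₁ b ≢ proj₁ c) xs →
                     AllPairs (λ b c → proj₁ b < proj₁ c) (sortByLabel xs)
sortByLabel-strict {xs} distinct = AllPairs.zipWith (λ (le , ne) → ℤP.≤∧≢⇒< le ne)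
  (sortByLabel-sorted xs , AllPairs-resp-↭ (λ ne eq → ne (sym eq)) (↭-sym (sortByLabel-↭ xs)) distinct)

countN-↭ : ∀ {xs ys} → xs ↭ ys → countN xs ≡ countN ys
countN-↭ _↭_.refl = refl
countN-↭ (_↭_.prep N p) = cong suc (countN-↭ p)
countN-↭ (_↭_.prep E p) = countN-↭ p
countN-↭ (_↭_.swap N N p) = cong (suc ∘ suc) (countN-↭ p)
countN-↭ (_↭_.swap N E p) = cong suc (countN-↭ p)
countN-↭ (_↭_.swap E N p) = cong suc (countN-↭ p)
countN-↭ (_↭_.swap E E p) = countN-↭ p
countN-↭ (_↭_.trans p q) = trans (countN-↭ p) (countN-↭ q)

countE-↭ : ∀ {xs ys} → xs ↭ ys → countE xs ≡ countE ys
countE-↭ _↭_.refl = refl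
countE-↭ (_↭_.prep E p) = cong suc (countE-↭ p)
countE-↭ (_↭_.prep N p) = countE-↭ p
countE-↭ (_↭_.swap N N p) = countE-↭ p
countE-↭ (_↭_.swap N E p) = cong suc (countE-↭ p)
countE-↭ (_↭_.swap E N p) = cong suc (countE-↭ p)
countE-↭ (_↭_.swap E E p) = cong (suc ∘ suc) (countE-↭ p)
countE-↭ (_↭_.trans p q) = trans (countE-↭ p) (countE-↭ q)

-- Complement of a sorted list of steps

N-labels : List LabelledStep → List ℤ
N-labels []            = []
N-labels ((l , N) ∷ L) = l ∷ N-labels L
N-labels ((l , E) ∷ L) = N-labels L

∈N-labels⁻ : ∀ L {l} → l ∈ N-labels L → (l , N) ∈ L
∈N-labels⁻ ((l , N) ∷ L) (here refl) = here refl
∈N-labels⁻ ((l , N) ∷ L) (there q)   = there (∈N-labels⁻ L q)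
∈N-labels⁻ ((l , E) ∷ L) q           = there (∈N-labels⁻ L q)

N-labels-All : ∀ {Q : ℤ → Set} L → (∀ {l} → (l , N) ∈ L → Q l) → All Q (N-labels L)
N-labels-All L h = All.tabulate (h ∘ ∈N-labels⁻ L)

N-labels-strict : ∀ {L} → AllPairs (λ b c → proj₁ b < proj₁ c) L → AllPairs _<_ (N-labels L)
N-labels-strict [] = []
N-labels-strict {(l , N) ∷ L} (l< ∷ strict) = N-labels-All L (All.lookup l<) ∷ N-labels-strict strict
N-labels-strict {(l , E) ∷ L} (l< ∷ strict) = N-labels-strict strict

length-N-labels : ∀ L → length (N-labels L) ≡ countN (map proj₂ L)
length-N-labels []            = refl
length-N-labels ((_ , N) ∷ L) = cong suc (length-N-labels L)
length-N-labels ((_ , E) ∷ L) = length-N-labels L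

E-below : ℤ → List LabelledStep → ℕ
E-below b []            = 0
E-below b ((l , N) ∷ L) = E-below b L
E-below b ((l , E) ∷ L) = ind (l ℤ.<? b) ℕ.+ E-below b L

E-below-none : ∀ {b L} → All (λ c → b ≤ proj₁ c) L → E-below b L ≡ 0
E-below-none {L = []} [] = refl
E-below-none {L = (_ , N) ∷ L} (_ ∷ h) = E-below-none h
E-below-none {L = (_ , E) ∷ L} (b≤l ∷ h) = cong₂ ℕ._+_ (ind-no _ (ℤP.≤⇒≯ b≤l)) (E-below-none h)

E-below-all : ∀ {b L} → All (λ c → proj₁ c < b) L → E-below b L ≡ countE (map proj₂ L)
E-below-all {L = []} [] = refl
E-below-all {L = (_ , N) ∷ L} (_ ∷ h) = E-below-all h
E-below-all {L = (_ , E) ∷ L} (l<b ∷ h) = cong₂ ℕ._+_ (ind-yes _ l<b) (E-below-all h)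

-- The labels are distinct, so at most one step has the label `a`.
E-below-suc : ∀ {a L} → AllPairs (λ b c → proj₁ b < proj₁ c) L →
              E-below (+ 1 + a) L ≡ E-below a L ⊎ (E-below (+ 1 + a) L ≡ suc (E-below a L) × (a , E) ∈ L)
E-below-suc [] = inj₁ refl
E-below-suc {a} {(l , N) ∷ L} (_ ∷ strict) with E-below-suc {a} strict
... | inj₁ eq       = inj₁ eq
... | inj₂ (eq , q) = inj₂ (eq , there q)
E-below-suc {a} {(l , E) ∷ L} (l< ∷ strict) with ℤP.<-cmp l a
... | tri< l<a _ _ rewrite ind-yes (l ℤ.<? a) l<a | ind-yes (l ℤ.<? (+ 1 + a))
    (ℤP.<-trans l<a (i<1+i a)) with E-below-suc {a} strict
...   | inj₁ eq       = inj₁ (cong suc eq)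
...   | inj₂ (eq , q) = inj₂ (cong suc eq , there q)
E-below-suc {a} {(l , E) ∷ L} (l< ∷ strict) | tri≈ l≮l refl _ = inj₂
  ( trans (cong₂ ℕ._+_ (ind-yes (l ℤ.<? (+ 1 + a)) (i<1+i l)) (E-below-none (All.map <⇒1+≤ l<)))
      (cong suc (sym (cong₂ ℕ._+_ (ind-no (l ℤ.<? a) l≮l) (E-below-none (All.map ℤP.<⇒≤ l<)))))
  , here refl)
E-below-suc {a} {(l , E) ∷ L} (l< ∷ strict) | tri> l≮a _ a<l = inj₁ (trans
  (E-below-none {+ 1 + a} {(l , E) ∷ L} (<⇒1+≤ a<l ∷ All.map (λ l<c → <⇒1+≤ (ℤP.<-trans a<l l<c)) l<))
  (sym (E-below-none {a} {(l , E) ∷ L} (ℤP.<⇒≤ a<l ∷ All.map (λ l<c → ℤP.<⇒≤ (ℤP.<-trans a<l l<c)) l<))))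

-- In a sorted list the earlier steps are those with smaller labels; `e` accumulates the east steps
-- already passed.
eBefore-sorted : ∀ {L} → AllPairs (λ b c → proj₁ b < proj₁ c) L → ∀ e →
                 eBefore e (map proj₂ L) ≡ map (λ l → e ℕ.+ E-below l L) (N-labels L)
eBefore-sorted [] e = refl
eBefore-sorted {(l , N) ∷ L} (l< ∷ strict) e = cong₂ _∷_
  (sym (trans (cong (e ℕ.+_) (E-below-none (All.map ℤP.<⇒≤ l<))) (ℕP.+-identityʳ e)))
  (eBefore-sorted strict e)
eBefore-sorted {(l , E) ∷ L} (l< ∷ strict) e = trans (eBefore-sorted strict (suc e))
  (LP.map-cong-local (N-labels-All L λ {l′} q → trans (sym (ℕP.+-suc e _))
    (cong (λ i → e ℕ.+ (i ℕ.+ E-below l′ L)) (sym (ind-yes (l ℤ.<? l′) (All.lookup l< q))))))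

labels-bounded : ∀ (L : List LabelledStep) → ∃ λ t → All (λ c → proj₁ c < + t) L
labels-bounded [] = 0 , []
labels-bounded ((l , _) ∷ L) = let t , h = labels-bounded L in
  suc (∣ l ∣ ℕ.+ t)
  , ℤP.≤-<-trans (i≤+∣i∣ l) (ℤ.+<+ (ℕ.s≤s (ℕP.m≤m+n ∣ l ∣ t)))
  ∷ All.map (λ lt → ℤP.<-≤-trans lt (ℤ.+≤+ (ℕP.m≤n⇒m≤1+n (ℕP.m≤n+m t ∣ l ∣)))) h

-- With F a the number of east labels below a, and G a the number of elements of D in [a - p , a - 1], the
-- difference G - F is weakly increasing in a; it vanishes at both ends, hence everywhere.
module CountE {D : ℤ → Set} (D? : ∀ z → Dec (D z)) (p : ℕ) (D-closed : ∀ {z} → D z → D (z + + p))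
              (D⇒0≤ : ∀ {z} → D z → + 0 ≤ z) {L : List LabelledStep}
              (strict : AllPairs (λ b c → proj₁ b < proj₁ c) L) (countE≡p : countE (map proj₂ L) ≡ p)
              (E⇒D : ∀ {e} → (e , E) ∈ L → D e × ¬ D (e - + p)) where

  private
    g : ℤ → ℕ
    g z = ind (D? z)

    F G : ℕ → ℕ
    F a = E-below (+ a) L
    G a = Σ (λ d → g (+ a - + suc d)) p

    G-suc : ∀ a → G (suc a) ℕ.+ g (+ a - + p) ≡ g (+ a) ℕ.+ G a
    G-suc a = begin
      G (suc a) ℕ.+ g (+ a - + p)
        ≡⟨ cong (ℕ._+ g (+ a - + p)) (Σ-cong p (λ d _ → cong g
            (((∀ a d → (+ 1 + a) - (+ 1 + d) ≡ a - d) ∋ solve-∀) (+ a) (+ d)))) ⟩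
      Σ (λ d → g (+ a - + d)) p ℕ.+ g (+ a - + p)
        ≡⟨ Σ-last (λ d → g (+ a - + d)) p ⟨
      g (+ a + + 0) ℕ.+ G a
        ≡⟨ cong (λ z → g z ℕ.+ G a) (ℤP.+-identityʳ (+ a)) ⟩
      g (+ a) ℕ.+ G a ∎
      where open ≡-Reasoning

    g-mono : ∀ a → g (a - + p) ℕ.≤ g a
    g-mono a with D? (a - + p)
    ... | no  _ = ℕ.z≤n
    ... | yes d = ℕP.≤-reflexive (sym (ind-yes (D? a)
        (subst D (((∀ a p → a - p + p ≡ a) ∋ solve-∀) a (+ p)) (D-closed d))))

    -- The monotonicity of `G - F`, cross-added to stay in ℕ. `F` grows only at an east label `a`;
    -- there `a` is in `D` and `a - p` is not, so `G` grows as well. Otherwise `G` cannot drop,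
    -- because `D` is closed under adding p.
    F+G-suc : ∀ a → F (suc a) ℕ.+ G a ℕ.≤ F a ℕ.+ G (suc a)
    F+G-suc a with E-below-suc {+ a} strict
    ... | inj₁ eq = ℕP.≤-trans (ℕP.≤-reflexive (cong (ℕ._+ G a) eq)) (ℕP.+-monoʳ-≤ (F a)
      (ℕP.+-cancelʳ-≤ (g (+ a - + p)) _ _ (ℕP.≤-trans (ℕP.+-monoʳ-≤ (G a) (g-mono (+ a)))
        (ℕP.≤-reflexive (trans (ℕP.+-comm (G a) _) (sym (G-suc a)))))))
    ... | inj₂ (eq , q) = ℕP.≤-reflexive (trans (cong (ℕ._+ G a) eq)
        (trans (sym (ℕP.+-suc (F a) (G a))) (cong (F a ℕ.+_) (sym G≡))))
      where
      G≡ : G (suc a) ≡ suc (G a)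
      G≡ = trans (sym (ℕP.+-identityʳ _)) (trans (cong (G (suc a) ℕ.+_) (sym (ind-no (D? _) (proj₂ (E⇒D q)))))
             (trans (G-suc a) (cong (ℕ._+ G a) (ind-yes (D? _) (proj₁ (E⇒D q))))))

    δ : ℕ → ℤ
    δ a = + G a - + F a

    δ-suc : ∀ a → δ a ≤ δ (suc a)
    δ-suc a = ≤-by (ℤ.+≤+ (F+G-suc a))
      (((∀ f g f′ g′ → (f + g′) - (f′ + g) ≡ (g′ - f′) - (g - f)) ∋ solve-∀) (+ F a) (+ G a) (+ F (suc a))
          (+ G (suc a)))

    δ-mono : ∀ a t → δ a ≤ δ (t ℕ.+ a)
    δ-mono a zero    = ℤP.≤-refl
    δ-mono a (suc t) = ℤP.≤-trans (δ-mono a t) (δ-suc (t ℕ.+ a))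

    F-0 : F 0 ≡ 0
    F-0 = go L (proj₁ ∘ E⇒D)
      where
      go : ∀ L → (∀ {e} → (e , E) ∈ L → D e) → E-below (+ 0) L ≡ 0
      go [] h = refl
      go ((_ , N) ∷ L) h = go L (h ∘ there)
      go ((l , E) ∷ L) h = cong₂ ℕ._+_ (ind-no (l ℤ.<? + 0) (ℤP.≤⇒≯ (D⇒0≤ (h (here refl))))) (go L (h ∘ there))

    G≤p : ∀ a → G a ℕ.≤ p
    G≤p a = ℕP.≤-trans (Σ-mono p (λ d → ind≤1 (D? _))) (ℕP.≤-reflexive (Σ-1 p (λ _ _ → refl)))

  -- At 0 no east label is smaller, so `F` is 0 and `G - F` is nonnegative. Past all labels `F` is
  -- `p`, the length of the window counted by `G`, so `G - F` is at most 0.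
  E-below≡ : ∀ a → E-below (+ a) L ≡ Σ (λ d → ind (D? (+ a - + suc d))) p
  E-below≡ a = sym (ℤP.+-injective (ℤP.i-j≡0⇒i≡j (+ G a) (+ F a) (ℤP.≤-antisym δ≤0 0≤δ)))
    where
    t = proj₁ (labels-bounded L)
    F≡p : F (t ℕ.+ a) ≡ p
    F≡p = trans (E-below-all (All.map (λ lt → ℤP.<-≤-trans lt (ℤ.+≤+ (ℕP.m≤m+n t a))) (proj₂ (labels-bounded L))))
        countE≡p
    δ≤0 : δ a ≤ + 0
    δ≤0 = ℤP.≤-trans (δ-mono a t) (subst (λ f → + G (t ℕ.+ a) - + f ≤ + 0) (sym F≡p)
        (ℤP.i≤j⇒i-j≤0 (ℤ.+≤+ (G≤p (t ℕ.+ a)))))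
    0≤δ : + 0 ≤ δ a
    0≤δ = ℤP.≤-trans (subst (λ f → + 0 ≤ + G 0 - + f) (sym F-0) (ℤ.+≤+ ℕ.z≤n))
        (subst (λ b → δ 0 ≤ δ b) (ℕP.+-identityʳ a) (δ-mono 0 a))

-- Partitions and first-column hook lengths

least : {Q : ℕ → Set} → (∀ i → Dec (Q i)) → ∀ i → Q i → ∃ λ m → Q m × (∀ j → j ℕ.< m → ¬ Q j)
least {Q} Q? i Qi with Q? 0
... | yes Q0 = 0 , Q0 , λ _ ()
least {Q} Q? zero    Qi | no ¬Q0 = contradiction Qi ¬Q0
least {Q} Q? (suc i) Qi | no ¬Q0 with least (Q? ∘ suc) i Qi
... | m , Qm , below = suc m , Qm , below′
  where
  below′ : ∀ j → j ℕ.< suc m → ¬ Q j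
  below′ zero    _           = ¬Q0
  below′ (suc j) (ℕ.s≤s j<m) = below j j<m

insertDesc-↭ : ∀ a xs → insertDesc a xs ↭ a ∷ xs
insertDesc-↭ a [] = ↭-refl
insertDesc-↭ a (y ∷ ys) with y ℕ.≤? a
... | yes _ = ↭-refl
... | no  _ = ↭-trans (prep y (insertDesc-↭ a ys)) (swap y a ↭-refl)

sortDesc-↭ : ∀ xs → sortDesc xs ↭ xs
sortDesc-↭ [] = ↭-refl
sortDesc-↭ (a ∷ xs) = ↭-trans (insertDesc-↭ a (sortDesc xs)) (prep a (sortDesc-↭ xs))

insertDesc-sorted : ∀ a {xs} → AllPairs ℕ._≥_ xs → AllPairs ℕ._≥_ (insertDesc a xs)
insertDesc-sorted a [] = [] ∷ []
insertDesc-sorted a {y ∷ ys} (y≥ ∷ sorted) with y ℕ.≤? a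
... | yes y≤a = (y≤a ∷ All.map (λ le → ℕP.≤-trans le y≤a) y≥) ∷ y≥ ∷ sorted
... | no  y≰a = ↭P.All-resp-↭ (↭-sym (insertDesc-↭ a ys)) (ℕP.<⇒≤ (ℕP.≰⇒> y≰a) ∷ y≥) ∷ insertDesc-sorted a sorted

sortDesc-sorted : ∀ xs → AllPairs ℕ._≥_ (sortDesc xs)
sortDesc-sorted [] = []
sortDesc-sorted (a ∷ xs) = insertDesc-sorted a (sortDesc-sorted xs)

sortDesc-strict : ∀ {xs} → Unique xs → AllPairs ℕ._>_ (sortDesc xs)
sortDesc-strict {xs} distinct = AllPairs.zipWith (λ (le , ne) → ℕP.≤∧≢⇒< le (ne ∘ sym))
  (sortDesc-sorted xs , AllPairs-resp-↭ (λ ne eq → ne (sym eq)) (↭-sym (sortDesc-↭ xs)) distinct)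

-- Positivity excludes trailing zeros, which `nth0` cannot detect.
record IsPartition (κ : Partition) : Set where
  field
    decreasing : ∀ i → nth0 κ (suc i) ℕ.≤ nth0 κ i
    positive   : All (0 ℕ.<_) κ

  ≤-head : ∀ i → nth0 κ i ℕ.≤ nth0 κ 0
  ≤-head zero    = ℕP.≤-refl
  ≤-head (suc i) = ℕP.≤-trans (decreasing i) (≤-head i)

  α-decreasing : ∀ i → + nth0 κ (suc i) - + suc i < + nth0 κ i - + i
  α-decreasing i = <-by (ℤ.+≤+ (decreasing i))
    (((∀ a b i → b - a ≡ (b - i) - (+ 1 + (a - (+ 1 + i)))) ∋ solve-∀) (+ nth0 κ (suc i)) (+ nth0 κ i) (+ i))

-- This keeps the truncated subtraction in `fromHooks′` exact and the resulting parts positive.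
length≤head : ∀ h hs → AllPairs ℕ._>_ (h ∷ hs) → All (0 ℕ.<_) (h ∷ hs) → length (h ∷ hs) ℕ.≤ h
length≤head h [] _ (0<h ∷ _) = 0<h
length≤head h (k ∷ ks) ((k<h ∷ _) ∷ strict) (_ ∷ pos) = ℕP.≤-trans (ℕ.s≤s (length≤head k ks strict pos)) k<h

fromHooks′-isPartition : ∀ {hs} → AllPairs ℕ._>_ hs → All (0 ℕ.<_) hs → IsPartition (fromHooks′ hs)
fromHooks′-isPartition strict pos = record { decreasing = dec strict pos ; positive = positive strict pos }
  where
  dec : ∀ {hs} → AllPairs ℕ._>_ hs → All (0 ℕ.<_) hs → ∀ i → nth0 (fromHooks′ hs) (suc i) ℕ.≤ nth0 (fromHooks′ hs) i
  dec [] [] i = ℕ.z≤n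
  dec (_ ∷ []) _ zero = ℕ.z≤n
  dec {h ∷ k ∷ ks} ((k<h ∷ _) ∷ _) _ zero = ℕP.∸-monoˡ-≤ (suc (length ks)) k<h
  dec (_ ∷ strict) (_ ∷ pos) (suc i) = dec strict pos i
  positive : ∀ {hs} → AllPairs ℕ._>_ hs → All (0 ℕ.<_) hs → All (0 ℕ.<_) (fromHooks′ hs)
  positive [] [] = []
  positive {h ∷ hs} strict@(_ ∷ strict′) pos@(_ ∷ pos′) = ℕP.m<n⇒0<n∸m
      (length≤head h hs strict pos) ∷ positive strict′ pos′

-- α read off from hook lengths: a row with hook length h gives `h + 1 - ℓ`, and the empty rows give
-- everything up to `- ℓ`, where ℓ is the number of rows.
InHooks : List ℕ → ℤ → Set
InHooks hs z = (∃ λ h → h ∈ hs × z ≡ + h + + 1 - + length hs) ⊎ z ≤ - + length hs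

first-α : ∀ h hs → AllPairs ℕ._>_ (h ∷ hs) → All (0 ℕ.<_) (h ∷ hs) →
          + (h ∸ length hs) - + 0 ≡ + h + + 1 - + length (h ∷ hs)
first-α h hs strict pos = trans (cong (_- + 0) (pos-∸ (ℕP.<⇒≤ (length≤head h hs strict pos))))
  (((∀ h l → h - l - + 0 ≡ h + + 1 - (+ 1 + l)) ∋ solve-∀) (+ h) (+ length hs))

-- Deleting the first row lowers ℓ by one and raises the remaining elements of α by one, whence the
-- recursive call at `z + + 1`.
α-fromHooks′⁻ : ∀ {hs} → AllPairs ℕ._>_ hs → All (0 ℕ.<_) hs → ∀ {z} → Inα (fromHooks′ hs) z → InHooks hs z
α-fromHooks′⁻ {[]} _ _ (i , refl) = inj₂ (≤-by (0≤+ i) (((∀ i → i - + 0 ≡ + 0 - (+ 0 - i)) ∋ solve-∀) (+ i)))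
α-fromHooks′⁻ {h ∷ hs} strict pos (zero , refl) = inj₁ (h , here refl , first-α h hs strict pos)
α-fromHooks′⁻ {h ∷ hs} (_ ∷ strict) (_ ∷ pos) {z} (suc i , eq) with α-fromHooks′⁻ strict pos {z + + 1}
    (i , trans (cong (_+ + 1) eq)
   (((∀ k i → k - (+ 1 + i) + + 1 ≡ k - i) ∋ solve-∀) (+ nth0 (fromHooks′ hs) i) (+ i)))
... | inj₁ (k , k∈ , eq′) = inj₁ (k , there k∈ , ≡-by eq′
  (((∀ z k l → (z + + 1) - (k + + 1 - l) ≡ z - (k + + 1 - (+ 1 + l))) ∋ solve-∀) z (+ k) (+ length hs)))
... | inj₂ le = inj₂ (≤-by le (((∀ z l → - l - (z + + 1) ≡ - (+ 1 + l) - z) ∋ solve-∀) z (+ length hs)))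

private
  next : ∀ {h} hs z → Inα (fromHooks′ hs) (z + + 1) → Inα (fromHooks′ (h ∷ hs)) z
  next hs z (i , eq) = suc i , ≡-by eq
    (((∀ z k i → (z + + 1) - (k - i) ≡ z - (k - (+ 1 + i))) ∋ solve-∀) z (+ nth0 (fromHooks′ hs) i) (+ i))

α-fromHooks′⁺ : ∀ {hs} → AllPairs ℕ._>_ hs → All (0 ℕ.<_) hs → ∀ {z} → InHooks hs z → Inα (fromHooks′ hs) z
α-fromHooks′⁺ {[]} _ _ {z} (inj₂ z≤0) = ∣ - z ∣ , trans (((∀ z → z ≡ + 0 - (- z)) ∋ solve-∀) z)
  (cong (λ y → + 0 - y) (sym (ℤP.0≤i⇒+∣i∣≡i (ℤP.neg-mono-≤ z≤0))))
α-fromHooks′⁺ {h ∷ hs} strict pos (inj₁ (_ , here refl , refl)) = 0 , sym (first-α h hs strict pos)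
α-fromHooks′⁺ {h ∷ hs} (_ ∷ strict) (_ ∷ pos) {z} (inj₁ (k , there k∈ , eq)) = next hs z (α-fromHooks′⁺ strict pos
  (inj₁ (k , k∈ , ≡-by eq (((∀ z k l → z - (k + + 1 - (+ 1 + l)) ≡ (z + + 1) - (k + + 1 - l)) ∋ solve-∀) z (+ k)
      (+ length hs)))))
α-fromHooks′⁺ {h ∷ hs} (_ ∷ strict) (_ ∷ pos) {z} (inj₂ le) = next hs z (α-fromHooks′⁺ strict pos
  (inj₂ (≤-by le (((∀ z l → - (+ 1 + l) - z ≡ - l - (z + + 1)) ∋ solve-∀) z (+ length hs)))))

module Hooks {hs : List ℕ} (unique : Unique hs) (positive : All (0 ℕ.<_) hs) where

  private
    sorted = sortDesc-strict unique
    positive′ = ↭P.All-resp-↭ (↭-sym (sortDesc-↭ hs)) positive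
    length≡ = ↭P.↭-length (sortDesc-↭ hs)

  isPartition : IsPartition (partitionWithHooks hs)
  isPartition = fromHooks′-isPartition sorted positive′

  α-partitionWithHooks⁻ : ∀ {z} → Inα (partitionWithHooks hs) z → InHooks hs z
  α-partitionWithHooks⁻ in-α with α-fromHooks′⁻ sorted positive′ in-α
  ... | inj₁ (h , h∈ , eq) = inj₁ (h , ↭P.∈-resp-↭ (sortDesc-↭ hs) h∈ , trans eq
      (cong (λ l → + h + + 1 - + l) length≡))
  ... | inj₂ le = inj₂ (ℤP.≤-trans le (ℤP.≤-reflexive (cong (λ l → - + l) length≡)))

  α-partitionWithHooks⁺ : ∀ {z} → InHooks hs z → Inα (partitionWithHooks hs) z
  α-partitionWithHooks⁺ (inj₁ (h , h∈ , eq)) = α-fromHooks′⁺ sorted positive′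
    (inj₁ (h , ↭P.∈-resp-↭ (↭-sym (sortDesc-↭ hs)) h∈ , trans eq (cong (λ l → + h + + 1 - + l) (sym length≡))))
  α-partitionWithHooks⁺ (inj₂ le) = α-fromHooks′⁺ sorted positive′
    (inj₂ (ℤP.≤-trans le (ℤP.≤-reflexive (cong (λ l → - + l) (sym length≡)))))

-- The first terms agree, both being the maximum of the common range; removing them leaves
-- decreasing sequences that again have a common range.
decreasing-unique : ∀ {a b : ℕ → ℤ} → (∀ i → a (suc i) < a i) → (∀ i → b (suc i) < b i) →
                    (∀ i → ∃ λ j → a i ≡ b j) → (∀ j → ∃ λ i → b j ≡ a i) → ∀ i → a i ≡ b i
decreasing-unique {a} {b} a-dec b-dec a⊆b b⊆a = go
  where
  ≤first : ∀ {c : ℕ → ℤ} → (∀ i → c (suc i) < c i) → ∀ i → c i ≤ c 0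
  ≤first c-dec zero    = ℤP.≤-refl
  ≤first c-dec (suc i) = ℤP.≤-trans (ℤP.<⇒≤ (c-dec i)) (≤first c-dec i)

  first≡ : a 0 ≡ b 0
  first≡ with a⊆b 0 | b⊆a 0
  ... | j , a0≡ | i , b0≡ = ℤP.≤-antisym (subst (_≤ b 0) (sym a0≡) (≤first b-dec j))
      (subst (_≤ a 0) (sym b0≡) (≤first a-dec i))

  tail : ∀ {c d : ℕ → ℤ} → (∀ i → c (suc i) < c i) → c 0 ≡ d 0 → (∀ i → ∃ λ j → c i ≡ d j) → ∀ i → ∃ λ j → c (suc i)
      ≡ d (suc j)
  tail {c} c-dec c0≡d0 c⊆d i with c⊆d (suc i)
  ... | zero  , eq = contradiction (trans eq (sym c0≡d0)) (ℤP.<⇒≢ (ℤP.<-≤-trans (c-dec i) (≤first c-dec i)))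
  ... | suc j , eq = j , eq

  go : ∀ i → a i ≡ b i
  go zero    = first≡
  go (suc i) = decreasing-unique (a-dec ∘ suc) (b-dec ∘ suc) (tail a-dec first≡ a⊆b) (tail b-dec (sym first≡) b⊆a) i

nth0-injective : ∀ {κ ν} → All (0 ℕ.<_) κ → All (0 ℕ.<_) ν → (∀ i → nth0 κ i ≡ nth0 ν i) → κ ≡ ν
nth0-injective [] [] eq = refl
nth0-injective [] (0<k ∷ _) eq = contradiction (eq 0) (ℕP.<⇒≢ 0<k)
nth0-injective (0<k ∷ _) [] eq = contradiction (sym (eq 0)) (ℕP.<⇒≢ 0<k)
nth0-injective (_ ∷ pos) (_ ∷ pos′) eq = cong₂ _∷_ (eq 0) (nth0-injective pos pos′ (eq ∘ suc))

α-injective : ∀ {κ ν} → IsPartition κ → IsPartition ν → (∀ {z} → Inα κ z → Inα ν z) → (∀ {z} → Inα ν z → Inα κ z) → κ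
    ≡ ν
α-injective {κ} {ν} κ-part ν-part κ⊆ν ν⊆κ = nth0-injective (positive κ-part) (positive ν-part) λ i →
  ℤP.+-injective (≡-by (decreasing-unique (α-decreasing κ-part) (α-decreasing ν-part) (λ i → κ⊆ν (i , refl))
      (λ i → ν⊆κ (i , refl)) i)
    (((∀ a b i → (a - i) - (b - i) ≡ a - b) ∋ solve-∀) (+ nth0 κ i) (+ nth0 ν i) (+ i)))
  where open IsPartition

-- Conjugate partitions

module Conjugate {κ : Partition} (κ-partition : IsPartition κ) where

  open IsPartition κ-partition

  private
    parts> : ℕ → Partition → ℕ
    parts> j κ = length (filter (λ k → suc j ℕ.≤? k) κ)

    nth0≤ : ∀ {k κ} → (∀ i → nth0 (k ∷ κ) (suc i) ℕ.≤ nth0 (k ∷ κ) i) → ∀ i → nth0 κ i ℕ.≤ k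
    nth0≤ dec zero    = dec 0
    nth0≤ dec (suc i) = ℕP.≤-trans (dec (suc i)) (nth0≤ dec i)

    accept : ∀ {j k} κ → j ℕ.< k → parts> j (k ∷ κ) ≡ suc (parts> j κ)
    accept {j} _ = cong length ∘ LP.filter-accept (λ k → suc j ℕ.≤? k)

    reject : ∀ {j k} κ → ¬ j ℕ.< k → parts> j (k ∷ κ) ≡ parts> j κ
    reject {j} _ = cong length ∘ LP.filter-reject (λ k → suc j ℕ.≤? k)

    parts>⁻ : ∀ {κ} → (∀ i → nth0 κ (suc i) ℕ.≤ nth0 κ i) → ∀ i j → i ℕ.< parts> j κ → j ℕ.< nth0 κ i
    parts>⁻ {[]} dec i j ()
    parts>⁻ {k ∷ κ} dec i j lt with suc j ℕ.≤? k
    parts>⁻ {k ∷ κ} dec zero    j lt | yes j<k = j<k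
    parts>⁻ {k ∷ κ} dec (suc i) j lt | yes j<k = parts>⁻ {κ} (dec ∘ suc) i j
        (ℕ.s<s⁻¹ (subst (suc i ℕ.<_) (accept κ j<k) lt))
    ... | no j≮k = contradiction (ℕP.≤-trans (parts>⁻ {κ} (dec ∘ suc) i j (subst (i ℕ.<_) (reject κ j≮k) lt))
        (nth0≤ dec i)) j≮k

    parts>⁺ : ∀ {κ} → (∀ i → nth0 κ (suc i) ℕ.≤ nth0 κ i) → ∀ i j → j ℕ.< nth0 κ i → i ℕ.< parts> j κ
    parts>⁺ {k ∷ κ} dec zero    j lt = subst (0 ℕ.<_) (sym (accept κ lt)) ℕ.z<s
    parts>⁺ {k ∷ κ} dec (suc i) j lt = subst (suc i ℕ.<_) (sym (accept κ (ℕP.<-≤-trans lt (nth0≤ dec i))))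
      (ℕ.s<s (parts>⁺ {κ} (dec ∘ suc) i j lt))

    max≡head : ∀ {κ} → (∀ i → nth0 κ (suc i) ℕ.≤ nth0 κ i) → foldr _⊔_ 0 κ ≡ nth0 κ 0
    max≡head {[]} dec = refl
    max≡head {k ∷ κ} dec = ℕP.m≥n⇒m⊔n≡m (subst (ℕ._≤ k) (sym (max≡head {κ} (dec ∘ suc))) (dec 0))

    nth0-applyUpTo-< : ∀ (f : ℕ → ℕ) m j → j ℕ.< m → nth0 (applyUpTo f m) j ≡ f j
    nth0-applyUpTo-< f (suc m) zero    _           = refl
    nth0-applyUpTo-< f (suc m) (suc j) (ℕ.s≤s j<m) = nth0-applyUpTo-< (f ∘ suc) m j j<m

    nth0-applyUpTo-≥ : ∀ (f : ℕ → ℕ) m j → m ℕ.≤ j → nth0 (applyUpTo f m) j ≡ 0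
    nth0-applyUpTo-≥ f zero    j       _           = refl
    nth0-applyUpTo-≥ f (suc m) (suc j) (ℕ.s≤s m≤j) = nth0-applyUpTo-≥ (f ∘ suc) m j m≤j

    nth0-conj : ∀ j → nth0 (conj κ) j ≡ parts> j κ
    nth0-conj j with ℕP.<-≤-connex j (foldr _⊔_ 0 κ)
    ... | inj₁ j<max = nth0-applyUpTo-< _ _ j j<max
    ... | inj₂ max≤j = trans (nth0-applyUpTo-≥ _ _ j max≤j) (sym (ℕP.n≤0⇒n≡0 (ℕP.≮⇒≥ λ 0<c →
      ℕP.<⇒≱ (parts>⁻ {κ} decreasing 0 j 0<c) (subst (ℕ._≤ j) (max≡head {κ} decreasing) max≤j))))

  -- With `conj⁺`: both inequalities say that the cell in row `i` and column `j` lies in the diagram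
  -- of κ.
  conj⁻ : ∀ {i j} → i ℕ.< nth0 (conj κ) j → j ℕ.< nth0 κ i
  conj⁻ {i} {j} lt = parts>⁻ {κ} decreasing i j (subst (i ℕ.<_) (nth0-conj j) lt)

  conj⁺ : ∀ {i j} → j ℕ.< nth0 κ i → i ℕ.< nth0 (conj κ) j
  conj⁺ {i} {j} lt = subst (i ℕ.<_) (sym (nth0-conj j)) (parts>⁺ {κ} decreasing i j lt)

  conj-isPartition : IsPartition (conj κ)
  conj-isPartition = record
    { decreasing = λ j → ℕP.≮⇒≥ λ lt → ℕP.<-irrefl refl (conj⁺ (ℕP.<-trans (ℕP.n<1+n j) (conj⁻ lt)))
    ; positive = AllP.applyUpTo⁺₁ _ _ λ {j} j<max → parts>⁺ {κ} decreasing 0 j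
        (subst (j ℕ.<_) (max≡head {κ} decreasing) j<max)
    }

  -- Otherwise κ_i + κ′_j = i + j + 1 for some i and j, counted from 0. But the sum is at least i +
  -- j + 2 if the cell (i, j) is in κ, and at most i + j if it is not.
  α-conj⁻ : ∀ {z} → Inα (conj κ) z → ¬ Inα κ (+ 1 - z)
  α-conj⁻ (j , refl) (i , eq) with ℕP.<-≤-connex j (nth0 κ i)
  ... | inj₁ j<k = ≤-absurd (ℤ.+≤+ j<k ⊕ ℤ.+≤+ (conj⁺ j<k) ⊕ ℤP.≤-reflexive (sym eq))
    (((∀ k d i j → (k + d + (+ 1 - (d - j))) - ((+ 1 + j) + (+ 1 + i) + (k - i)) ≡ - + 1) ∋ solve-∀) (+ nth0 κ i)
        (+ nth0 (conj κ) j) (+ i) (+ j))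
  ... | inj₂ k≤j = ≤-absurd (ℤ.+≤+ k≤j ⊕ ℤ.+≤+ d≤i ⊕ ℤP.≤-reflexive eq)
    (((∀ k d i j → (j + i + (k - i)) - (k + d + (+ 1 - (d - j))) ≡ - + 1) ∋ solve-∀) (+ nth0 κ i) (+ nth0 (conj κ) j)
        (+ i) (+ j))
    where
    d≤i : nth0 (conj κ) j ℕ.≤ i
    d≤i = ℕP.≮⇒≥ λ lt → ℕP.<⇒≱ (conj⁻ lt) k≤j

  -- Let m be the first row with κ_m - m at most 1 - z. Equality is excluded, so κ_m is at most j =
  -- m - z, while the rows before m are longer than j. Column j thus has exactly m cells, and z = m
  -- - j.
  α-conj⁺ : ∀ {z} → ¬ Inα κ (+ 1 - z) → Inα (conj κ) z
  α-conj⁺ {z} ∉α with least (λ i → + nth0 κ i - + i ℤ.≤? w) (nth0 κ 0 ℕ.+ ∣ w ∣) far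
    where
    w = + 1 - z
    -- No part exceeds the first, so at this row κ_top - top is at most - ∣ w ∣.
    top = nth0 κ 0 ℕ.+ ∣ w ∣
    far : + nth0 κ top - + top ≤ w
    far = ≤-by (ℤ.+≤+ (≤-head top) ⊕ i≤+∣i∣ (- w))
      (trans (cong (λ a → (+ nth0 κ 0 + + a) - (+ nth0 κ top + - w)) (ℤP.∣-i∣≡∣i∣ w))
        (((∀ k₀ k a w → (k₀ + a) - (k + - w) ≡ w - (k - (k₀ + a))) ∋ solve-∀) (+ nth0 κ 0) (+ nth0 κ top)
            (+ ∣ w ∣) w))
  ... | m , m≤ , below = ∣ j ∣ , (begin
    z                                ≡⟨ ((∀ z m → z ≡ m - (m - z)) ∋ solve-∀) z (+ m) ⟩
    + m - j                          ≡⟨ cong₂ (λ a b → + a - b) (sym d≡m) (sym +∣j∣≡j) ⟩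
    + nth0 (conj κ) ∣ j ∣ - + ∣ j ∣  ∎)
    where
    open ≡-Reasoning
    j = + m - z
    k≤j : + nth0 κ m ≤ j
    k≤j = ≤-by (<⇒1+≤ (ℤP.≤∧≢⇒< m≤ (λ eq → ∉α (m , sym eq))))
      (((∀ k m z → (+ 1 - z) - (+ 1 + (k - m)) ≡ (m - z) - k) ∋ solve-∀) (+ nth0 κ m) (+ m) z)
    +∣j∣≡j : + ∣ j ∣ ≡ j
    +∣j∣≡j = ℤP.0≤i⇒+∣i∣≡i (ℤP.≤-trans (0≤+ _) k≤j)
    d≤m : nth0 (conj κ) ∣ j ∣ ℕ.≤ m
    d≤m = ℕP.≮⇒≥ λ lt → ℕP.<⇒≱ (conj⁻ lt) (ℤP.drop‿+≤+ (subst (+ nth0 κ m ≤_) (sym +∣j∣≡j) k≤j))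
    m≤d : ∀ m → (∀ i → i ℕ.< m → ¬ + nth0 κ i - + i ≤ + 1 - z) → (∀ {a} → + a ≡ + m - z → m ℕ.≤ nth0 (conj κ) a)
    m≤d zero    _     _  = ℕ.z≤n
    m≤d (suc m) below {a} eq = conj⁺ (ℤP.drop‿+<+ (<-by (<⇒1+≤ (ℤP.≰⇒> (below m ℕP.≤-refl)) ⊕ ℤP.≤-reflexive eq)
      (((∀ k m z a → (k - m + ((+ 1 + m) - z)) - ((+ 1 + (+ 1 - z)) + a) ≡ k - (+ 1 + a)) ∋ solve-∀) (+ nth0 κ m)
          (+ m) z (+ a))))
    d≡m : nth0 (conj κ) ∣ j ∣ ≡ m
    d≡m = ℕP.≤-antisym d≤m (m≤d m below +∣j∣≡j)

-- The Pak–Stanley labelling of a path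

record DominantStable (n p : ℕ) (ω : ℤ → ℤ) : Set where
  field
    affine   : IsAffinePerm n ω
    dominant : Dominant n ω
    stable   : Stable p ω

  ω-injective : ∀ {x y} → ω x ≡ ω y → x ≡ y
  ω-injective = proj₁ (proj₁ affine)

  ω-surjective : ∀ y → ∃ λ x → ω x ≡ y
  ω-surjective y = let x , h = proj₂ (proj₁ affine) y in x , h refl

  periodic : ∀ i → ω (i + + n) ≡ ω i + + n
  periodic = proj₁ (proj₂ affine)

  window-sum : windowSum n ω ≡ + ((n ℕ.* suc n) / 2)
  window-sum = proj₂ (proj₂ affine)

  open Periodic n ω periodic public

proj₂-annotate : ∀ {f : ℕ × ℕ → ℤ} i j s → map proj₂ (map (λ q → f (proj₁ q) , proj₂ q) (annotate i j s)) ≡ s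
proj₂-annotate i j []      = refl
proj₂-annotate i j (N ∷ s) = cong (N ∷_) (proj₂-annotate i (suc j) s)
proj₂-annotate i j (E ∷ s) = cong (E ∷_) (proj₂-annotate (suc i) j s)

module PakStanley {n p : ℕ} .{{_ : NonZero n}} .{{_ : NonZero p}} (coprime : Coprime n p) {ω : ℤ → ℤ}
    (hyp : DominantStable n p ω)
                  {x : Path} (is𝒜 : Is𝒜 n p ω x) where

  open DominantStable hyp
  open DyckPath coprime (proj₁ is𝒜)
  open Hooks H-unique (All.tabulate H-positive) using (α-partitionWithHooks⁻; α-partitionWithHooks⁺)

  private
    ℓ = length (H n p x)
    -- The least integer outside α(φ(x)): everything up to `- ℓ` is inside, and `1 - ℓ` would
    -- require a hook of length 0.
    o = + 1 - + ℓ

    P : ℤ → Set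
    P z = + 1 ≤ ω (o + z)

    InHooks⇒¬P : ∀ {z} → InHooks (H n p x) (o + z) → ¬ P z
    InHooks⇒¬P = ≤0⇒¬1≤ ∘ proj₁ (proj₂ is𝒜 _) ∘ α-partitionWithHooks⁺

    P⇒0≤ : ∀ {z} → P z → + 0 ≤ z
    P⇒0≤ {z} Pz = ℤP.≮⇒≥ λ z<0 → InHooks⇒¬P (inj₂ (≤-by (<⇒1+≤ z<0)
      (((∀ z l → + 0 - (+ 1 + z) ≡ - l - (+ 1 - l + z)) ∋ solve-∀) z (+ ℓ)))) Pz

    P⇒∉H : ∀ {z} → P z → ∣ z ∣ ∉ H n p x
    P⇒∉H {z} Pz z∈H = InHooks⇒¬P (inj₁ (∣ z ∣ , z∈H , trans
      (((∀ z l → + 1 - l + z ≡ z + + 1 - l) ∋ solve-∀) z (+ ℓ))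
      (cong (λ y → y + + 1 - + ℓ) (sym (ℤP.0≤i⇒+∣i∣≡i (P⇒0≤ Pz)))))) Pz

    ∉H⇒P : ∀ {z} → + 0 ≤ z → ∣ z ∣ ∉ H n p x → P z
    ∉H⇒P {z} 0≤z z∉H with + 1 ℤ.≤? ω (o + z)
    ... | yes Pz = Pz
    ... | no ¬Pz with α-partitionWithHooks⁻ (proj₂ (proj₂ is𝒜 (o + z)) (¬1≤⇒≤0 ¬Pz))
    ...   | inj₂ le = ⊥-elim (≤-absurd (0≤z ⊕ le) (((∀ z l → (z + - l) - (+ 0 + (+ 1 - l + z)) ≡ - + 1) ∋ solve-∀) z
        (+ ℓ)))
    ...   | inj₁ (h , h∈ , eq) = contradiction (subst (_∈ H n p x) (cong ∣_∣ (sym z≡h)) h∈) z∉H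
      where
      z≡h : z ≡ + h
      z≡h = ≡-by eq (((∀ z h l → (+ 1 - l + z) - (h + + 1 - l) ≡ z - h) ∋ solve-∀) z (+ h) (+ ℓ))

    open Labels {P} P⇒0≤ P⇒∉H ∉H⇒P

    steps : List LabelledStep
    steps = map (λ q → label n p (proj₁ (proj₁ q)) (proj₂ (proj₁ q)) , proj₂ q) (annotate 0 0 x)

    L : List LabelledStep
    L = sortByLabel steps

    strict : AllPairs (λ b c → proj₁ b < proj₁ c) L
    strict = sortByLabel-strict (AllPairsP.map⁺ labels-distinct)

    steps↭ : map proj₂ L ↭ x
    steps↭ = subst (map proj₂ L ↭_) (proj₂-annotate 0 0 x) (↭P.map⁺ proj₂ (sortByLabel-↭ steps))

    ∈L⁻ : ∀ {l c} → (l , c) ∈ L → ∃ λ u → ∃ λ v → ((u , v) , c) ∈ annotate 0 0 x × l ≡ label n p u v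
    ∈L⁻ q with ∈-map⁻ _ (↭P.∈-resp-↭ (sortByLabel-↭ steps) q)
    ... | ((u , v) , c) , q′ , refl = u , v , q′ , refl

    N⇒P : ∀ {l} → (l , N) ∈ L → P l × ¬ P (l - + n)
    N⇒P q with ∈L⁻ q
    ... | u , v , q′ , refl = vertex-P (start∈vertices 0 0 x q′) , N-minimal q′

    -- D = {z : z - n ∈ Δ}, whose minimal elements modulo p are the labels of the east steps.
    D : ℤ → Set
    D z = P (z - + n)

    D? : ∀ z → Dec (D z)
    D? z = + 1 ℤ.≤? ω (o + (z - + n))

    E⇒D : ∀ {e} → (e , E) ∈ L → D e × ¬ D (e - + p)
    E⇒D q with ∈L⁻ q
    ... | u , v , q′ , refl = subst P (label-suc-E n p u v) (vertex-P (E-end∈vertices 0 0 x q′))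
      , E-minimal q′ ∘ subst P (((∀ l n p → l - p - n ≡ l - n - p) ∋ solve-∀) (label n p u v) (+ n) (+ p))

    D-closed : ∀ {z} → D z → D (z + + p)
    D-closed {z} Dz = ℤP.≤-trans Dz (ℤP.≤-trans (ℤP.<⇒≤ (stable (o + (z - + n))))
      (ℤP.≤-reflexive (cong ω (((∀ o z n p → o + (z - n) + p ≡ o + (z + p - n)) ∋ solve-∀) o z (+ n) (+ p)))))

    D⇒0≤ : ∀ {z} → D z → + 0 ≤ z
    D⇒0≤ {z} Dz = ≤-by (P⇒0≤ Dz ⊕ 0≤+ n) (((∀ z n → (z - n + n) - (+ 0 + + 0) ≡ z - + 0) ∋ solve-∀) z (+ n))

    open CountE {D} D? p (λ {z} → D-closed {z}) (λ {z} → D⇒0≤ {z}) strict (trans (countE-↭ steps↭) countE≡) E⇒D using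
        (E-below≡)

    ω-n : ∀ z → ω (o + (z - + n)) ≡ ω (o + z) - + n
    ω-n z = trans (cong ω (((∀ o z n → o + (z - n) ≡ o + z - n) ∋ solve-∀) o z (+ n))) (ω-- (o + z))

    N-value : ∀ {l} → (l , N) ∈ L → + 1 ≤ ω (o + l) × ω (o + l) ≤ + n
    N-value {l} q = let Pl , ¬Pl-n = N⇒P q in Pl ,
      ≤-by (¬1≤⇒≤0 (¬Pl-n ∘ subst (+ 1 ≤_) (sym (ω-n l))))
          (((∀ w n → + 0 - (w - n) ≡ n - w) ∋ solve-∀) (ω (o + l)) (+ n))

    value : ℤ → ℕ
    value l = ∣ ω (o + l) ∣

    +value : ∀ {l} → (l , N) ∈ L → + value l ≡ ω (o + l)
    +value q = ℤP.0≤i⇒+∣i∣≡i (ℤP.≤-trans (ℤ.+≤+ ℕ.z≤n) (proj₁ (N-value q)))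

    E-below-N : ∀ {l} → (l , N) ∈ L → E-below l L ≡ PS n p ω (value l)
    E-below-N {l} q = begin
      E-below l L                                               ≡⟨ cong (λ a → E-below a L) (sym +∣l∣) ⟩
      E-below (+ ∣ l ∣) L                                       ≡⟨ E-below≡ ∣ l ∣ ⟩
      Σ (λ d → ind (D? (+ ∣ l ∣ - + suc d))) p                  ≡⟨ cong
          (λ a → Σ (λ d → ind (D? (a - + suc d))) p) +∣l∣ ⟩
      Σ (λ d → ind (D? (l - + suc d))) p                        ≡⟨ cong (Σ (λ d → ind (D? (l - + suc d))))
          (sym suc[p∸1]) ⟩
      Σ (λ d → ind (D? (l - + suc d))) (suc (p ∸ 1))            ≡⟨ Σ-last (λ d → ind (D? (l - + suc d))) (p ∸ 1) ⟩
      Σ (λ d → ind (D? (l - + suc d))) (p ∸ 1) ℕ.+ ind (D? (l - + suc (p ∸ 1)))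
        ≡⟨ cong₂ ℕ._+_ (Σ-cong (p ∸ 1) (λ d _ → ind-cong _ _ (D⇒inversion d) (inversion⇒D d))) (ind-no _ last) ⟩
      Σ (λ d → ind (ω b ℤ.<? ω (b - + suc d))) (p ∸ 1) ℕ.+ 0    ≡⟨ ℕP.+-identityʳ _ ⟩
      Σ (λ d → ind (ω b ℤ.<? ω (b - + suc d))) (p ∸ 1)          ≡⟨ PS-window n p ω-injective periodic b (value l)
          (sym (+value q)) ⟨
      PS n p ω (value l) ∎
      where
      open ≡-Reasoning
      b = o + l
      +∣l∣ = ℤP.0≤i⇒+∣i∣≡i (P⇒0≤ (proj₁ (N⇒P q)))
      suc[p∸1] = ℕP.suc-pred p
      reassoc : ∀ d → o + (l - d) ≡ b - d
      reassoc d = ((∀ o l d → o + (l - d) ≡ o + l - d) ∋ solve-∀) o l d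
      D⇒n< : ∀ d → D (l - d) → + n < ω (b - d)
      D⇒n< d Dd = <-by (subst (+ 1 ≤_) (trans (ω-n (l - d)) (cong (λ z → ω z - + n) (reassoc d))) Dd)
        (((∀ w n → (w - n) - + 1 ≡ w - (+ 1 + n)) ∋ solve-∀) (ω (b - d)) (+ n))
      D⇒inversion : ∀ d → D (l - + suc d) → ω b < ω (b - + suc d)
      D⇒inversion d Dd = ℤP.≤-<-trans (proj₂ (N-value q)) (D⇒n< (+ suc d) Dd)
      -- A value between `ω b` and `n` would have to occur to the right of `b` by dominance, so an
      -- inversion to the left of `b` needs a value above `n`.
      inversion⇒D : ∀ d → ω b < ω (b - + suc d) → D (l - + suc d)
      inversion⇒D d lt = subst (+ 1 ≤_) (sym (trans (ω-n (l - + suc d)) (cong (λ z → ω z - + n) (reassoc (+ suc d)))))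
        (≤-by (<⇒1+≤ (ℤP.≰⇒> n≱)) (((∀ w n → w - (+ 1 + n) ≡ w - n - + 1) ∋ solve-∀) (ω (b - + suc d)) (+ n)))
        where
        n≱ : ¬ ω (b - + suc d) ≤ + n
        n≱ le = ≤-absurd (<⇒1+≤ (dominant b (b - + suc d) (proj₁ (N-value q)) lt le) ⊕ 0≤+ (suc d))
          (((∀ b d → (b - d + d) - (+ 1 + b + + 0) ≡ - + 1) ∋ solve-∀) b (+ suc d))
      last : ¬ D (l - + suc (p ∸ 1))
      last Dd = ℤP.<-asym (ℤP.≤-<-trans (proj₂ (N-value q)) (D⇒n< (+ p) (subst (λ a → D (l - + a)) suc[p∸1] Dd)))
        (subst (λ z → ω (b - + p) < ω z) (((∀ b p → b - p + p ≡ b) ∋ solve-∀) b (+ p)) (stable (b - + p)))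

    -- By dominance the values increase along the sorted north labels; n increasing numbers between
    -- 1 and n are 1, ..., n. So the k-th north label has value k.
    values : map value (N-labels L) ≡ applyUpTo suc n
    values = trans (increasing-interval 1 (map value (N-labels L)) increasing
        (AllP.map⁺ (N-labels-All L λ q → ℤP.drop‿+≤+ (subst (+ 1 ≤_) (sym (+value q)) (proj₁ (N-value q)))))
        (AllP.map⁺ (N-labels-All L λ q → ℕ.s≤s (subst (value _ ℕ.≤_) (sym length≡n)
            (ℤP.drop‿+≤+ (subst (_≤ + n) (sym (+value q)) (proj₂ (N-value q))))))))
      (cong (applyUpTo suc) length≡n)
      where
      length≡n : length (map value (N-labels L)) ≡ n
      length≡n = trans (LP.length-map value (N-labels L))
          (trans (length-N-labels L) (trans (countN-↭ steps↭) countN≡))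
      increasing : AllPairs ℕ._<_ (map value (N-labels L))
      increasing = AllPairsP.map⁺ (AllPairs-refine step (N-labels-All L id) (N-labels-strict strict))
        where
        step : ∀ {l l′} → (l , N) ∈ L → (l′ , N) ∈ L → l < l′ → value l ℕ.< value l′
        step {l} {l′} q q′ l<l′ with ℤP.<-cmp (ω (o + l)) (ω (o + l′))
        ... | tri< lt _ _ = ℤP.drop‿+<+ (subst₂ _<_ (sym (+value q)) (sym (+value q′)) lt)
        ... | tri≈ _ eq _ = contradiction (≡-by (ω-injective eq)
            (((∀ o l l′ → (o + l) - (o + l′) ≡ l - l′) ∋ solve-∀) o l l′)) (ℤP.<⇒≢ l<l′)
        ... | tri> _ _ gt = contradiction (dominant (o + l′) (o + l) (proj₁ (N-value q′)) gt (proj₂ (N-value q)))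
            (ℤP.<-asym (ℤP.+-monoʳ-< o l<l′))

  complement-zeta : complement (zeta n p x) ≡ applyDownFrom (λ i → PS n p ω (suc i)) n
  complement-zeta = begin
    reverse (eBefore 0 (map proj₂ L))                         ≡⟨ cong reverse (eBefore-sorted strict 0) ⟩
    reverse (map (λ l → E-below l L) (N-labels L))            ≡⟨ cong reverse
        (LP.map-cong-local (N-labels-All L E-below-N)) ⟩
    reverse (map (PS n p ω ∘ value) (N-labels L))             ≡⟨ cong reverse (LP.map-∘ (N-labels L)) ⟩
    reverse (map (PS n p ω) (map value (N-labels L)))         ≡⟨ cong (reverse ∘ map (PS n p ω)) values ⟩
    reverse (map (PS n p ω) (applyUpTo suc n))                ≡⟨ cong reverse (LP.map-applyUpTo suc (PS n p ω) n) ⟩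
    reverse (applyUpTo (λ i → PS n p ω (suc i)) n)            ≡⟨ LP.reverse-applyUpTo _ n ⟩
    applyDownFrom (λ i → PS n p ω (suc i)) n ∎
    where open ≡-Reasoning

-- The Dyck path of a set of labels

module Walk {n p : ℕ} .{{_ : NonZero n}} .{{_ : NonZero p}} (coprime : Coprime n p) {P : ℤ → Set}
    (P? : ∀ z → Dec (P z))
            (P-+n : ∀ {z} → P z → P (z + + n)) (P-+p : ∀ {z} → P z → P (z + + p))
            (P⇒0≤ : ∀ {z} → P z → + 0 ≤ z) (P-0 : P (+ 0)) where

  private
    P-+* : ∀ {m} → (∀ {z} → P z → P (z + + m)) → ∀ k {z} → P z → P (z + + k * + m)
    P-+* {m} closed zero    {z} Pz = subst P (sym (ℤP.+-identityʳ z)) Pz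
    P-+* {m} closed (suc k) {z} Pz = subst P (((∀ z k m → z + k * m + m ≡ z + (+ 1 + k) * m) ∋ solve-∀) z (+ k)
        (+ m)) (closed (P-+* closed k Pz))

    walk : ℕ → ℕ → ℕ → Path
    walk zero    i j = []
    walk (suc f) i j with P? (label n p (suc i) j)
    ... | yes _ = E ∷ walk f (suc i) j
    ... | no  _ = N ∷ walk f i (suc j)

    -- `minimal` concerns the point one step east and one step south of the current one; when the
    -- next step is east, that point is the corner of the top square under it.
    record Invariant (f i j : ℕ) : Set where
      field
        remaining : f ℕ.+ (i ℕ.+ j) ≡ n ℕ.+ p
        i≤p       : i ℕ.≤ p
        j≤n       : j ℕ.≤ n
        in-P      : P (label n p i j)
        minimal   : ¬ P (label n p i j - + n - + p)
    open Invariant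

    invariant-E : ∀ {f i j} → Invariant (suc f) i j → P (label n p (suc i) j) → Invariant f (suc i) j
    invariant-E {f} {i} {j} inv Pl = record
      { remaining = trans (ℕP.+-suc f (i ℕ.+ j)) (remaining inv)
      ; i≤p = ℕP.*-cancelʳ-≤ (suc i) p n (ℕP.≤-trans (0≤label⇒ {n} {p} {suc i} {j} (P⇒0≤ Pl))
                (subst (j ℕ.* p ℕ.≤_) (ℕP.*-comm n p) (ℕP.*-monoˡ-≤ p (j≤n inv))))
      ; j≤n = j≤n inv
      ; in-P = Pl
      ; minimal = λ Pm → minimal inv (subst P (trans (cong (λ l → l - + n - + p + + n) (label-suc-E n p i j))
          (((∀ l n p → l - n - n - p + n ≡ l - n - p) ∋ solve-∀) (label n p i j) (+ n) (+ p))) (P-+n Pm))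
      }

    invariant-N : ∀ {f i j} → Invariant (suc f) i j → ¬ P (label n p (suc i) j) → Invariant f i (suc j)
    invariant-N {f} {i} {j} inv ¬Pl = record
      { remaining = trans (cong (f ℕ.+_) (ℕP.+-suc i j)) (trans (ℕP.+-suc f (i ℕ.+ j)) (remaining inv))
      ; i≤p = i≤p inv
      ; j≤n = ℕP.≤∧≢⇒< (j≤n inv) j≢n
      ; in-P = subst P (sym (label-suc-N n p i j)) (P-+p (in-P inv))
      ; minimal = ¬Pl ∘ subst P (trans (cong (λ l → l - + n - + p) (label-suc-N n p i j)) (trans
          (((∀ l n p → l + p - n - p ≡ l - n) ∋ solve-∀) (label n p i j) (+ n) (+ p)) (sym (label-suc-E n p i j))))
      }
      where
      -- At height `n` the label to the east is `(p - suc i) * n`, a nonnegative multiple of n and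
      -- so in `P`: the walk goes east there.
      j≢n : j ≢ n
      j≢n refl = ¬Pl (subst P (begin
        + 0 + + (p ∸ suc i) * + n      ≡⟨ cong (λ a → + 0 + a * + n) (pos-∸ i<p) ⟩
        + 0 + (+ p - + suc i) * + n    ≡⟨ ((∀ n p i → + 0 + (p - i) * n ≡ n * p - i * n) ∋ solve-∀) (+ n) (+ p)
            (+ suc i) ⟩
        + n * + p - + suc i * + n      ≡⟨ label≡ n p (suc i) n ⟨
        label n p (suc i) n            ∎) (P-+* P-+n (p ∸ suc i) P-0))
        where
        open ≡-Reasoning
        i<p : i ℕ.< p
        i<p = ℕP.+-cancelʳ-≤ n (suc i) p (ℕP.≤-trans (ℕP.m≤n+m (suc i ℕ.+ n) f)
          (ℕP.≤-reflexive (trans (ℕP.+-suc f (i ℕ.+ n)) (trans (remaining inv) (ℕP.+-comm n p)))))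

    walk-counts : ∀ f i j → Invariant f i j → i ℕ.+ countE (walk f i j) ≡ p × j ℕ.+ countN (walk f i j) ≡ n
    walk-counts zero i j inv = trans (ℕP.+-identityʳ i) i≡p , trans (ℕP.+-identityʳ j) j≡n
      where
      i≡p : i ≡ p
      i≡p = ℕP.≤-antisym (i≤p inv) (ℕP.+-cancelˡ-≤ n p i (ℕP.≤-trans (ℕP.≤-reflexive (sym (remaining inv)))
        (ℕP.≤-trans (ℕP.≤-reflexive (ℕP.+-comm i j)) (ℕP.+-monoˡ-≤ i (j≤n inv)))))
      j≡n : j ≡ n
      j≡n = ℕP.+-cancelˡ-≡ p j n (trans (cong (ℕ._+ j) (sym i≡p)) (trans (remaining inv) (ℕP.+-comm n p)))
    walk-counts (suc f) i j inv with P? (label n p (suc i) j)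
    ... | yes Pl = let e , m = walk-counts f (suc i) j (invariant-E inv Pl) in trans (ℕP.+-suc i _) e , m
    ... | no ¬Pl = let e , m = walk-counts f i (suc j) (invariant-N inv ¬Pl) in e , trans (ℕP.+-suc j _) m

    walk-vertices : ∀ f i j → Invariant f i j → All (λ v → P (label n p (proj₁ v) (proj₂ v)))
        (vertices i j (walk f i j))
    walk-vertices zero i j inv = in-P inv ∷ []
    walk-vertices (suc f) i j inv with P? (label n p (suc i) j)
    ... | yes Pl = in-P inv ∷ walk-vertices f (suc i) j (invariant-E inv Pl)
    ... | no ¬Pl = in-P inv ∷ walk-vertices f i (suc j) (invariant-N inv ¬Pl)

    walk-minimal : ∀ f i j → Invariant f i j → All (λ a → ¬ P
        (label n p (proj₁ (proj₁ a)) (proj₂ (proj₁ a)) - + n - + p)) (annotate i j (walk f i j))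
    walk-minimal zero i j inv = []
    walk-minimal (suc f) i j inv with P? (label n p (suc i) j)
    ... | yes Pl = minimal inv ∷ walk-minimal f (suc i) j (invariant-E inv Pl)
    ... | no ¬Pl = minimal inv ∷ walk-minimal f i (suc j) (invariant-N inv ¬Pl)

    start : Invariant (n ℕ.+ p) 0 0
    start = record
      { remaining = ℕP.+-identityʳ (n ℕ.+ p)
      ; i≤p = ℕ.z≤n
      ; j≤n = ℕ.z≤n
      ; in-P = P-0
      ; minimal = λ P- → ≤-absurd (P⇒0≤ P- ⊕ ℤ.+≤+ (ℕ.>-nonZero⁻¹ n) ⊕ 0≤+ p)
          (((∀ n p → (+ 0 - n - p + n + p) - (+ 0 + + 1 + + 0) ≡ - + 1) ∋ solve-∀) (+ n) (+ p))
      }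

  path : Path
  path = walk (n ℕ.+ p) 0 0

  private
    vertex-P : ∀ {u v} → (u , v) ∈ vertices 0 0 path → P (label n p u v)
    vertex-P = All.lookup (walk-vertices (n ℕ.+ p) 0 0 start)

  path-dyck : IsDyck n p path
  path-dyck = let e , m = walk-counts (n ℕ.+ p) 0 0 start in
    m , e , All.tabulate λ { {u , v} q → 0≤label⇒ {n} {p} {u} {v} (P⇒0≤ (vertex-P q)) }

  -- Adding p moves up one square in a column. If `h` were in `P`, so would be the label of the top
  -- square under the east step, against `minimal`.
  H⇒¬P : ∀ {h} → h ∈ H n p path → ¬ P (+ h)
  H⇒¬P h∈H Ph with ∈H⁻ path h∈H
  ... | u , v , k , q , k<v , eq , _ = All.lookup (walk-minimal (n ℕ.+ p) 0 0 start) q (subst P (begin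
    + _ + + m * + p                                    ≡⟨ cong (_+ + m * + p) (trans eq (label≡ n p (suc u) k)) ⟩
    (+ k * + p - + suc u * + n) + + m * + p            ≡⟨
        ((∀ k m u n p → (k * p - (+ 1 + u) * n) + m * p ≡ ((+ 1 + k + m) * p - u * n) - n - p) ∋ solve-∀) (+ k) (+ m)
            (+ u) (+ n) (+ p) ⟩
    (+ (suc k ℕ.+ m) * + p - + u * + n) - + n - + p    ≡⟨ cong (λ w → (+ w * + p - + u * + n) - + n - + p)
        (ℕP.m+[n∸m]≡n k<v) ⟩
    (+ v * + p - + u * + n) - + n - + p                ≡⟨ cong (λ l → l - + n - + p) (label≡ n p u v) ⟨
    label n p u v - + n - + p ∎) (P-+* P-+p m Ph))
    where
    open ≡-Reasoning
    m = v ∸ suc k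

  private
    bézout : ∃ λ s → ∃ λ t → + 1 ≡ s * + p + t * + n
    bézout with Coprimality.coprime-Bézout coprime
    ... | Bézout.+- x y eq = - + y , + x , (begin
      + 1                                      ≡⟨ ((∀ a → + 1 ≡ (+ 1 + a) - a) ∋ solve-∀) (+ y * + p) ⟩
      (+ 1 + + y * + p) - + y * + p            ≡⟨ cong (λ a → (+ 1 + a) - + y * + p) (ℤP.pos-* y p) ⟨
      + (1 ℕ.+ y ℕ.* p) - + y * + p            ≡⟨ cong (λ a → + a - + y * + p) eq ⟩
      + (x ℕ.* n) - + y * + p                  ≡⟨ cong (_- + y * + p) (ℤP.pos-* x n) ⟩
      + x * + n - + y * + p                    ≡⟨ ((∀ x y n p → x * n - y * p ≡ - y * p + x * n) ∋ solve-∀) (+ x)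
          (+ y) (+ n) (+ p) ⟩
      - + y * + p + + x * + n ∎)
      where open ≡-Reasoning
    ... | Bézout.-+ x y eq = + y , - + x , (begin
      + 1                                      ≡⟨ ((∀ a → + 1 ≡ (+ 1 + a) - a) ∋ solve-∀) (+ x * + n) ⟩
      (+ 1 + + x * + n) - + x * + n            ≡⟨ cong (λ a → (+ 1 + a) - + x * + n) (ℤP.pos-* x n) ⟨
      + (1 ℕ.+ x ℕ.* n) - + x * + n            ≡⟨ cong (λ a → + a - + x * + n) eq ⟩
      + (y ℕ.* p) - + x * + n                  ≡⟨ cong (_- + x * + n) (ℤP.pos-* y p) ⟩
      + y * + p - + x * + n                    ≡⟨ ((∀ x y n p → y * p - x * n ≡ y * p + - x * n) ∋ solve-∀) (+ x)
          (+ y) (+ n) (+ p) ⟩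
      + y * + p + - + x * + n ∎)
      where open ≡-Reasoning

    -- Bézout expresses z through p and n; reducing the coefficient of p modulo n moves the lattice
    -- point to a height between 0 and n - 1.
    coordinates : ∀ z → ∃ λ k → ∃ λ w → k ℕ.< n × z ≡ + k * + p + w * + n
    coordinates z with bézout
    ... | s , t , eq = (z * s) %ℕ n , (z * s) /ℕ n * + p + z * t , n%ℕd<d (z * s) n , (begin
      z                                         ≡⟨ ℤP.*-identityʳ z ⟨
      z * + 1                                   ≡⟨ cong (z *_) eq ⟩
      z * (s * + p + t * + n)                   ≡⟨ ((∀ z s t n p → z * (s * p + t * n) ≡ (z * s) * p + z * t * n) ∋
          solve-∀) z s t (+ n) (+ p) ⟩
      (z * s) * + p + z * t * + n               ≡⟨ cong (λ a → a * + p + z * t * + n) (a≡a%ℕn+[a/ℕn]*n (z * s) n) ⟩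
      (+ k + q * + n) * + p + z * t * + n       ≡⟨ ((∀ k q n p b → (k + q * n) * p + b * n ≡ k * p +
          (q * p + b) * n) ∋ solve-∀) (+ k) q (+ n) (+ p) (z * t) ⟩
      + k * + p + (q * + p + z * t) * + n ∎)
      where
      open ≡-Reasoning
      k = (z * s) %ℕ n
      q = (z * s) /ℕ n

    -- If the east step in column `u` were at height at most `k`, its end would have a label in `P`,
    -- and adding copies of p would bring `h` into `P`.
    gap∈H : ∀ {h u k} → 0 ℕ.< h → k ℕ.< n → + h ≡ label n p (suc u) k → ¬ P (+ h) → h ∈ H n p path
    gap∈H {h} {u} {k} 0<h k<n h≡ ¬Ph = ∈H⁺ path q (ℕP.≰⇒> v≰k) h≡ 0<h
      where
      u< : u ℕ.< countE path
      u< = subst (u ℕ.<_) (sym (proj₁ (proj₂ path-dyck)))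
          (ℕP.*-cancelʳ-≤ (suc u) p n (ℕP.≤-trans (0≤label⇒ {n} {p} {suc u} {k} (subst (+ 0 ≤_) h≡ (0≤+ h)))
        (subst (k ℕ.* p ℕ.≤_) (ℕP.*-comm n p) (ℕP.*-monoˡ-≤ p (ℕP.<⇒≤ k<n)))))
      E-step = E-step-in-column 0 0 path {u} ℕ.z≤n u<
      v = proj₁ E-step
      q = proj₂ E-step
      v≰k : ¬ v ℕ.≤ k
      v≰k v≤k = ¬Ph (subst P (begin
        label n p (suc u) v + + (k ∸ v) * + p             ≡⟨ cong₂ (λ l m → l + m * + p) (label≡ n p (suc u) v)
            (pos-∸ v≤k) ⟩
        + v * + p - + suc u * + n + (+ k - + v) * + p     ≡⟨
            ((∀ v u n p k → v * p - u * n + (k - v) * p ≡ k * p - u * n) ∋ solve-∀) (+ v) (+ suc u) (+ n) (+ p)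
                (+ k) ⟩
        + k * + p - + suc u * + n                         ≡⟨ trans (sym (label≡ n p (suc u) k)) (sym h≡) ⟩
        + h ∎) (P-+* P-+p (k ∸ v) (vertex-P (E-end∈vertices 0 0 path q))))
        where open ≡-Reasoning

    -- For `w` nonnegative, `h` is a nonnegative combination of n and p and so lies in `P`. A gap
    -- therefore has `w = - suc u` and is the label of `(suc u , k)`.
    gap : ∀ {h k} w → 0 ℕ.< h → k ℕ.< n → + h ≡ + k * + p + w * + n → ¬ P (+ h) → h ∈ H n p path
    gap {h} {k} (+ w) _ _ h≡ ¬Ph = contradiction
      (subst P (trans (cong (_+ + w * + n) (ℤP.+-identityˡ (+ k * + p))) (sym h≡)) (P-+* P-+n w (P-+* P-+p k P-0)))
          ¬Ph
    gap {h} {k} -[1+ u ] 0<h k<n h≡ ¬Ph = gap∈H {h} {u} {k} 0<h k<n (trans h≡ (trans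
      (((∀ k u n p → k * p + - u * n ≡ k * p - u * n) ∋ solve-∀) (+ k) (+ suc u) (+ n) (+ p))
          (sym (label≡ n p (suc u) k)))) ¬Ph

  ¬P⇒H : ∀ {h} → ¬ P (+ h) → h ∈ H n p path
  ¬P⇒H {zero}  ¬Ph = contradiction P-0 ¬Ph
  ¬P⇒H {suc h} ¬Ph = let k , w , k<n , eq = coordinates (+ suc h) in gap w ℕ.z<s k<n eq ¬Ph

dyckPath : ∀ {n p} .{{_ : NonZero n}} .{{_ : NonZero p}} → Coprime n p → {P : ℤ → Set} → (∀ z → Dec (P z)) →
           (∀ {z} → P z → P (z + + n)) → (∀ {z} → P z → P (z + + p)) → (∀ {z} → P z → + 0 ≤ z) → P (+ 0) →
           ∃ λ x → IsDyck n p x × (∀ {h} → h ∈ H n p x → ¬ P (+ h)) × (∀ {h} → ¬ P (+ h) → h ∈ H n p x)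
dyckPath coprime P? P-+n P-+p P⇒0≤ P-0 = path , path-dyck , H⇒¬P , ¬P⇒H
  where open Walk coprime P? P-+n P-+p P⇒0≤ P-0

-- Existence of 𝒜(ω)

decreasing-length : ∀ d ds → AllPairs ℕ._>_ (d ∷ ds) → length ds ℕ.≤ d
decreasing-length d [] _ = ℕ.z≤n
decreasing-length d (e ∷ es) ((e<d ∷ _) ∷ dec) = ℕP.≤-trans (ℕ.s≤s (decreasing-length e es dec)) e<d

decreasing-interval : ∀ {ds} → AllPairs ℕ._>_ ds → All (ℕ._< length ds) ds → ds ≡ downFrom (length ds)
decreasing-interval [] [] = refl
decreasing-interval {d ∷ ds} dec@(d> ∷ dec′) (ℕ.s≤s d≤ ∷ _) with ℕP.≤-antisym d≤ (decreasing-length d ds dec)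
... | refl = cong (d ∷_) (decreasing-interval dec′ d>)

-- Distinct residues below n, sorted downwards, can only be n - 1, ..., 0.
sum-residues : ∀ {n} (r : ℕ → ℕ) → (∀ {i j} → i ℕ.< j → j ℕ.< n → r i ≢ r j) → (∀ i → r i ℕ.< n) →
               Σ r n ≡ sum (downFrom n)
sum-residues {n} r distinct r<n = begin
  Σ r n                ≡⟨ sum-applyUpTo r n ⟨
  sum rs               ≡⟨ sum-↭ (sortDesc-↭ rs) ⟨
  sum (sortDesc rs)    ≡⟨ cong sum (decreasing-interval (sortDesc-strict (UniqueP.applyUpTo⁺₁ r n distinct))
                            (↭P.All-resp-↭ (↭-sym (sortDesc-↭ rs))
                                (subst (λ m → All (ℕ._< m) rs) (sym length≡n) (AllP.applyUpTo⁺₂ r n r<n)))) ⟩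
  sum (downFrom (length (sortDesc rs)))  ≡⟨ cong (sum ∘ downFrom) length≡n ⟩
  sum (downFrom n) ∎
  where
  open ≡-Reasoning
  rs = applyUpTo r n
  length≡n : length (sortDesc rs) ≡ n
  length≡n = trans (↭P.↭-length (sortDesc-↭ rs)) (LP.length-applyUpTo r n)

triangular-doubled : ∀ n → (n ℕ.+ sum (downFrom n)) ℕ.* 2 ≡ n ℕ.* suc n
triangular-doubled zero    = refl
triangular-doubled (suc n) = trans (((∀ n s → (1 ℕ.+ n ℕ.+ s) ℕ.* 2 ≡ 2 ℕ.+ n ℕ.* 2 ℕ.+ s ℕ.* 2) ∋ ℕRing.solve-∀) n
    (n ℕ.+ sum (downFrom n)))
  (trans (cong (2 ℕ.+ n ℕ.* 2 ℕ.+_) (triangular-doubled n))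
      (((∀ n → 2 ℕ.+ n ℕ.* 2 ℕ.+ n ℕ.* (1 ℕ.+ n) ≡ (1 ℕ.+ n) ℕ.* (2 ℕ.+ n)) ∋ ℕRing.solve-∀) n))

triangular : ∀ n → (n ℕ.* suc n) / 2 ≡ n ℕ.+ sum (downFrom n)
triangular n = trans (cong (_/ 2) (sym (triangular-doubled n))) (m*n/n≡m (n ℕ.+ sum (downFrom n)) 2)

Σ-ind-< : ∀ c m → c ℕ.≤ m → Σ (λ t → ind (t ℕ.<? c)) m ≡ c
Σ-ind-< zero    m       _         = Σ-ε m (λ t _ → ind-no (t ℕ.<? 0) (λ ()))
Σ-ind-< (suc c) (suc m) (ℕ.s≤s c≤m) = cong₂ ℕ._+_ (ind-yes (0 ℕ.<? suc c) ℕ.z<s)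
  (trans (Σ-cong m (λ t _ → ind-cong (suc t ℕ.<? suc c) (t ℕ.<? c) ℕ.s<s⁻¹ ℕ.s<s)) (Σ-ind-< c m c≤m))

Σ-const : ∀ a m → Σ (λ _ → a) m ≡ m ℕ.* a
Σ-const a zero    = refl
Σ-const a (suc m) = cong (a ℕ.+_) (Σ-const a m)

term≤Σ : ∀ f n {i} → i ℕ.< n → f i ℕ.≤ Σ f n
term≤Σ f (suc n) {zero}  _           = ℕP.m≤m+n (f 0) _
term≤Σ f (suc n) {suc i} (ℕ.s≤s i<n) = ℕP.≤-trans (term≤Σ (f ∘ suc) n i<n) (ℕP.m≤n+m _ (f 0))

ℤΣ-* : ∀ f n c → ℤSum.Σ (λ i → f i * c) n ≡ ℤSum.Σ f n * c
ℤΣ-* f zero    c = refl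
ℤΣ-* f (suc n) c = trans (cong (ℤ._+_ (f 0 * c)) (ℤΣ-* (f ∘ suc) n c)) (sym (ℤP.*-distribʳ-+ c (f 0) _))

foldr-applyUpTo : ∀ (f : ℕ → ℤ) n → foldr _+_ (+ 0) (applyUpTo f n) ≡ ℤSum.Σ f n
foldr-applyUpTo f zero    = refl
foldr-applyUpTo f (suc n) = cong (ℤ._+_ (f 0)) (foldr-applyUpTo (f ∘ suc) n)

length-≡-count : {Q : ℕ → Set} (Q? : ∀ h → Dec (Q h)) {m : ℕ} → (∀ {h} → Q h → h ℕ.< m) → {hs : List ℕ} → Unique hs →
                    (∀ {h} → h ∈ hs → Q h) → (∀ {h} → Q h → h ∈ hs) → length hs ≡ Σ (λ h → ind (Q? h)) m
length-≡-count Q? {m} Q⇒<m unique ∈⇒Q Q⇒∈ = trans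
  (↭P.↭-length (∼bag⇒↭ (unique∧set⇒bag unique (UniqueP.filter⁺ Q? (UniqueP.upTo⁺ m)) (mk⇔
    (λ h∈ → ∈-filter⁺ Q? (∈-upTo⁺ (Q⇒<m (∈⇒Q h∈))) (∈⇒Q h∈))
    (λ h∈ → Q⇒∈ (proj₂ (∈-filter⁻ Q? {xs = upTo m} h∈)))))))
  (length-filter Q? id m)

module Existence {n p : ℕ} .{{_ : NonZero n}} .{{_ : NonZero p}} (coprime : Coprime n p) {ω : ℤ → ℤ}
    (hyp : DominantStable n p ω) where

  open DominantStable hyp

  private
    -- ω (1 + i) = 1 + r i + q i * n with 0 ≤ r i < n, so ω (1 + i + s n) ≥ 1 iff s ≥ - q i.
    r : ℕ → ℕ
    r i = (ω (+ suc i) - + 1) %ℕ n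

    q : ℕ → ℤ
    q i = (ω (+ suc i) - + 1) /ℕ n

    r<n : ∀ i → r i ℕ.< n
    r<n i = n%ℕd<d (ω (+ suc i) - + 1) n

    ω-suc : ∀ i → ω (+ suc i) ≡ + suc (r i) + q i * + n
    ω-suc i = ≡-by (a≡a%ℕn+[a/ℕn]*n (ω (+ suc i) - + 1) n)
      (((∀ w r x → (w - + 1) - (r + x) ≡ w - ((+ 1 + r) + x)) ∋ solve-∀) (ω (+ suc i)) (+ r i) (q i * + n))

    r-distinct : ∀ {i j} → i ℕ.< j → j ℕ.< n → r i ≢ r j
    r-distinct {i} {j} i<j j<n eq with %ℕ-cong⇒ n (ω (+ suc i) - + 1) (ω (+ suc j) - + 1) eq
    ... | t , eq′ = ℕP.<⇒≢ i<j (proj₁ (residue-unique n (+ 0) t (ℕP.<-trans i<j j<n) j<n (≡-by 1+i≡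
      (((∀ i j x n → (+ 1 + i) - (+ 1 + j + x) ≡ (i + + 0 * n) - (j + x)) ∋ solve-∀) (+ i) (+ j) (t * + n) (+ n)))))
      where
      1+i≡ : + suc i ≡ + suc j + t * + n
      1+i≡ = ω-injective (trans (≡-by eq′ (((∀ a b x → (a - + 1) - ((b - + 1) + x) ≡ a - (b + x)) ∋ solve-∀)
          (ω (+ suc i)) (ω (+ suc j)) (t * + n)))
        (sym (ω-+ (+ suc j) t)))

    -- The numbers `suc (r i)` are a rearrangement of 1, ..., n and already account for the whole
    -- window sum n(n + 1)/2.
    Σq≡0 : ℤSum.Σ q n ≡ + 0
    Σq≡0 = ℤP.*-cancelʳ-≡ (ℤSum.Σ q n) (+ 0) (+ n) {{n≢0}}
        (≡-by total (((∀ a x → (a + x) - a ≡ x - + 0) ∋ solve-∀) (+ Σ (suc ∘ r) n) (ℤSum.Σ q n * + n)))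
      where
      open ≡-Reasoning
      n≢0 : ℤ.NonZero (+ n)
      n≢0 = ℕ.≢-nonZero (ℕ.≢-nonZero⁻¹ n)
      total : + Σ (suc ∘ r) n + ℤSum.Σ q n * + n ≡ + Σ (suc ∘ r) n
      total = begin
        + Σ (suc ∘ r) n + ℤSum.Σ q n * + n                        ≡⟨ cong₂ _+_ (Σ-pos (suc ∘ r) n)
            (sym (ℤΣ-* q n (+ n))) ⟩
        ℤSum.Σ (λ i → + suc (r i)) n + ℤSum.Σ (λ i → q i * + n) n ≡⟨ ℤSum.Σ-· _ _ n ⟨
        ℤSum.Σ (λ i → + suc (r i) + q i * + n) n                  ≡⟨ ℤSum.Σ-cong n (λ i _ → sym (ω-suc i)) ⟩
        ℤSum.Σ (λ i → ω (+ suc i)) n                              ≡⟨ foldr-applyUpTo (λ i → ω (+ suc i)) n ⟨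
        windowSum n ω                                             ≡⟨ window-sum ⟩
        + ((n ℕ.* suc n) / 2)                                     ≡⟨ cong +_ (triangular n) ⟩
        + (n ℕ.+ sum (downFrom n))                                ≡⟨ cong +_
            (cong₂ ℕ._+_ (sym (Σ-1 {λ _ → 1} n (λ _ _ → refl))) (sym (sum-residues r r-distinct r<n))) ⟩
        + (Σ (λ _ → 1) n ℕ.+ Σ r n)                               ≡⟨ cong +_ (Σ-· (λ _ → 1) r n) ⟨
        + Σ (suc ∘ r) n ∎

    ω-split : ∀ i s → ω (+ suc i + s * + n) ≡ + suc (r i) + (q i + s) * + n
    ω-split i s = trans (ω-+ (+ suc i) s) (trans (cong (_+ s * + n) (ω-suc i))
      (((∀ r q s n → r + q * n + s * n ≡ r + (q + s) * n) ∋ solve-∀) (+ suc (r i)) (q i) s (+ n)))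

    ω-positive : ∀ i s → + 0 ≤ q i + s → + 1 ≤ ω (+ suc i + s * + n)
    ω-positive i s 0≤ = subst (+ 1 ≤_) (sym (ω-split i s)) (≤-by (0≤+ (r i) ⊕ ℤP.*-monoʳ-≤-nonNeg (+ n) 0≤)
      (((∀ r t n → (r + t * n) - (+ 0 + + 0 * n) ≡ ((+ 1 + r) + t * n) - + 1) ∋ solve-∀) (+ r i) (q i + s) (+ n)))

    ω-nonpositive : ∀ i s → q i + s < + 0 → ω (+ suc i + s * + n) ≤ + 0
    ω-nonpositive i s <0 = subst (_≤ + 0) (sym (ω-split i s))
        (≤-by (ℤ.+≤+ (r<n i) ⊕ ℤP.*-monoʳ-≤-nonNeg (+ n) (<⇒1+≤ <0))
      (((∀ r t n → (n + + 0 * n) - ((+ 1 + r) + (+ 1 + t) * n) ≡ + 0 - ((+ 1 + r) + t * n)) ∋ solve-∀) (+ r i)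
          (q i + s) (+ n)))

    -- A common bound for the `∣ q i ∣`. With `K = T * n`, all values of ω beyond `K` are positive
    -- and those up to `- K` are not.
    T : ℕ
    T = Σ (λ i → ∣ q i ∣) n

    q≤T : ∀ {i} → i ℕ.< n → q i ≤ + T
    q≤T {i} i<n = ℤP.≤-trans (i≤+∣i∣ (q i)) (ℤ.+≤+ (term≤Σ (∣_∣ ∘ q) n i<n))

    -T≤q : ∀ {i} → i ℕ.< n → - + T ≤ q i
    -T≤q {i} i<n = ≤-by (ℤP.≤-trans (i≤+∣i∣ (- q i))
        (ℤ.+≤+ (subst (ℕ._≤ T) (sym (ℤP.∣-i∣≡∣i∣ (q i))) (term≤Σ (∣_∣ ∘ q) n i<n))))
      (((∀ t q → t - - q ≡ q - - t) ∋ solve-∀) (+ T) (q i))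

    K : ℕ
    K = T ℕ.* n

    -- Enumerates the symmetric window 1 - K, ..., K from the left. It starts at a number congruent
    -- to 1, so its blocks of length n match the index of `q` and `r`.
    at : ℕ → ℤ
    at d = + 1 - + K + + d

    decompose : ∀ z → ∃ λ i → ∃ λ s → i ℕ.< n × z ≡ + suc i + s * + n
    decompose z = (z - + 1) %ℕ n , (z - + 1) /ℕ n , n%ℕd<d (z - + 1) n , ≡-by (a≡a%ℕn+[a/ℕn]*n (z - + 1) n)
      (((∀ z i x → (z - + 1) - (i + x) ≡ z - ((+ 1 + i) + x)) ∋ solve-∀) z (+ ((z - + 1) %ℕ n))
          ((z - + 1) /ℕ n * + n))

    +K : + K ≡ + T * + n
    +K = ℤP.pos-* T n

    far-right : ∀ {z} → + 1 + + K ≤ z → + 1 ≤ ω z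
    far-right {z} le with decompose z
    ... | i , s , i<n , refl with q i + s ℤ.<? + 0
    ...   | no  ≮0 = ω-positive i s (ℤP.≮⇒≥ ≮0)
    ...   | yes <0 = ⊥-elim (≤-absurd (le ⊕ ℤ.+≤+ i<n ⊕ ℤP.*-monoʳ-≤-nonNeg (+ n)
        (<⇒1+≤ <0 ⊕ -T≤q i<n) ⊕ ℤP.≤-reflexive (sym +K))
      (((∀ K T n i s q → ((+ 1 + i) + s * n + n + (+ 0 + q) * n + K) -
          ((+ 1 + K) + (+ 1 + i) + (+ 1 + (q + s) + - T) * n + T * n) ≡ - + 1) ∋ solve-∀)
         (+ K) (+ T) (+ n) (+ i) s (q i)))

    far-left : ∀ {z} → z ≤ - + K → ω z ≤ + 0
    far-left {z} le with decompose z
    ... | i , s , i<n , refl with q i + s ℤ.<? + 0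
    ...   | yes <0 = ω-nonpositive i s <0
    ...   | no  ≮0 = ⊥-elim (≤-absurd (le ⊕ 0≤+ i ⊕ ℤP.*-monoʳ-≤-nonNeg (+ n) (ℤP.≮⇒≥ ≮0 ⊕ q≤T i<n) ⊕ ℤP.≤-reflexive
        (sym +K))
      (((∀ K T n i s q → (- K + i + ((q + s) + T) * n + K) - (((+ 1 + i) + s * n) + + 0 + (+ 0 + q) * n + T * n)
          ≡ - + 1) ∋ solve-∀)
         (+ K) (+ T) (+ n) (+ i) s (q i)))

    ω≤0? : ∀ z → Dec (ω z ≤ + 0)
    ω≤0? z = ω z ℤ.≤? + 0

    -- Counts the nonpositive values in the class of `suc i` within the window: block `t` has
    -- quotient `q i + t - T`, which is negative exactly for `t < T - q i`.
    c : ℕ → ℕ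
    c i = ∣ + T - q i ∣

    +c : ∀ {i} → i ℕ.< n → + c i ≡ + T - q i
    +c i<n = ℤP.0≤i⇒+∣i∣≡i (ℤP.i≤j⇒0≤j-i (q≤T i<n))

    c≤2T : ∀ {i} → i ℕ.< n → c i ℕ.≤ 2 ℕ.* T
    c≤2T {i} i<n = ℤP.drop‿+≤+ (subst₂ _≤_ (sym (+c i<n)) (sym (ℤP.pos-* 2 T)) (≤-by (-T≤q i<n)
      (((∀ T q → q - - T ≡ + 2 * T - (T - q)) ∋ solve-∀) (+ T) (q i))))

    at-block : ∀ t i → at (t ℕ.* n ℕ.+ i) ≡ + suc i + (+ t - + T) * + n
    at-block t i = trans (cong₂ (λ a b → + 1 - a + (b + + i)) +K (ℤP.pos-* t n))
      (((∀ T n t i → + 1 - T * n + (t * n + i) ≡ (+ 1 + i) + (t - T) * n) ∋ solve-∀) (+ T) (+ n) (+ t) (+ i))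

    nonpositive⇔ : ∀ {i} → i ℕ.< n → ∀ t → ind (ω≤0? (at (t ℕ.* n ℕ.+ i))) ≡ ind (t ℕ.<? c i)
    nonpositive⇔ {i} i<n t = ind-cong _ _
      (λ ω≤0 → ℕP.≰⇒> λ c≤t → ≤0⇒¬1≤ (subst (λ z → ω z ≤ + 0) (at-block t i) ω≤0) (ω-positive i (+ t - + T)
        (≤-by (subst (_≤ + t) (+c i<n) (ℤ.+≤+ c≤t))
            (((∀ t T q → t - (T - q) ≡ (q + (t - T)) - + 0) ∋ solve-∀) (+ t) (+ T) (q i)))))
      (λ t<c → subst (λ z → ω z ≤ + 0) (sym (at-block t i)) (ω-nonpositive i (+ t - + T)
        (<-by (subst (+ suc t ≤_) (+c i<n) (ℤ.+≤+ t<c))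
            (((∀ t T q → (T - q) - (+ 1 + t) ≡ + 0 - (+ 1 + (q + (t - T)))) ∋ solve-∀) (+ t) (+ T) (q i)))))

    Σc≡K : Σ c n ≡ K
    Σc≡K = ℤP.+-injective (begin
      + Σ c n                                       ≡⟨ Σ-pos c n ⟩
      ℤSum.Σ (λ i → + c i) n                        ≡⟨ ℤP.+-identityʳ _ ⟨
      ℤSum.Σ (λ i → + c i) n + + 0                  ≡⟨ cong (ℤ._+_ (ℤSum.Σ (λ i → + c i) n)) Σq≡0 ⟨
      ℤSum.Σ (λ i → + c i) n + ℤSum.Σ q n           ≡⟨ ℤSum.Σ-· _ q n ⟨
      ℤSum.Σ (λ i → + c i + q i) n                  ≡⟨ ℤSum.Σ-cong n
          (λ i i<n → trans (cong (_+ q i) (+c i<n)) (((∀ T q → T - q + q ≡ T) ∋ solve-∀) (+ T) (q i))) ⟩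
      ℤSum.Σ (λ _ → + T) n                          ≡⟨ Σ-pos (λ _ → T) n ⟨
      + Σ (λ _ → T) n                               ≡⟨ cong +_ (trans (Σ-const T n) (ℕP.*-comm n T)) ⟩
      + K ∎)
      where open ≡-Reasoning

    -- The window sum makes γ(ω) have charge 0: half of a large symmetric window lies in γ(ω).
    charge : Σ (λ d → ind (ω≤0? (at d))) (2 ℕ.* T ℕ.* n) ≡ K
    charge = begin
      Σ (λ d → ind (ω≤0? (at d))) (2 ℕ.* T ℕ.* n)                            ≡⟨ Σ-blocks _ (2 ℕ.* T) n ⟩
      Σ (λ t → Σ (λ i → ind (ω≤0? (at (t ℕ.* n ℕ.+ i)))) n) (2 ℕ.* T)        ≡⟨ Σ-comm _ (2 ℕ.* T) n ⟩
      Σ (λ i → Σ (λ t → ind (ω≤0? (at (t ℕ.* n ℕ.+ i)))) (2 ℕ.* T)) n        ≡⟨ Σ-cong n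
          (λ i i<n → trans (Σ-cong (2 ℕ.* T) (λ t _ → nonpositive⇔ i<n t)) (Σ-ind-< (c i) (2 ℕ.* T) (c≤2T i<n))) ⟩
      Σ c n                                                                  ≡⟨ Σc≡K ⟩
      K ∎
      where open ≡-Reasoning

    width : ℕ
    width = 2 ℕ.* T ℕ.* n

    at-width : at width ≡ + 1 + + K
    at-width = trans (cong₂ (λ a b → + 1 - a + b) +K (trans (ℤP.pos-* (2 ℕ.* T) n) (cong (_* + n) (ℤP.pos-* 2 T))))
      (trans (((∀ T n → + 1 - T * n + + 2 * T * n ≡ + 1 + T * n) ∋ solve-∀) (+ T) (+ n))
          (cong (ℤ._+_ (+ 1)) (sym +K)))

    module FromFirst (d₀ : ℕ) (1≤ω : + 1 ≤ ω (at d₀)) (below : ∀ e → e ℕ.< d₀ → ¬ + 1 ≤ ω (at e)) where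

      d₀≤width : d₀ ℕ.≤ width
      d₀≤width = ℕP.≮⇒≥ λ lt → below width lt (far-right (ℤP.≤-reflexive (sym at-width)))

      o : ℤ
      o = at d₀

      P : ℤ → Set
      P z = + 1 ≤ ω (o + z)

      P? : ∀ z → Dec (P z)
      P? z = + 1 ℤ.≤? ω (o + z)

      P-+n : ∀ {z} → P z → P (z + + n)
      P-+n {z} Pz = subst (+ 1 ≤_) (trans (sym (periodic (o + z))) (cong ω (ℤP.+-assoc o z (+ n)))) (≤-by (Pz ⊕ 0≤+ n)
        (((∀ w n → (w + n) - (+ 1 + + 0) ≡ (w + n) - + 1) ∋ solve-∀) (ω (o + z)) (+ n)))

      P-+p : ∀ {z} → P z → P (z + + p)
      P-+p {z} Pz = subst (λ y → + 1 ≤ ω y) (ℤP.+-assoc o z (+ p)) (ℤP.≤-trans Pz (ℤP.<⇒≤ (stable (o + z))))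

      P⇒0≤ : ∀ {z} → P z → + 0 ≤ z
      P⇒0≤ {z} Pz = ℤP.≮⇒≥ λ z<0 → negative z<0 (+ d₀ + z ℤ.<? + 0)
        where
        -- To the left of the window `far-left` applies; inside it the minimality of `d₀` does.
        negative : z < + 0 → Dec (+ d₀ + z < + 0) → ⊥
        negative z<0 (yes lt) = ≤0⇒¬1≤ (far-left (≤-by (<⇒1+≤ lt)
          (((∀ K d z → + 0 - (+ 1 + (d + z)) ≡ - K - (+ 1 - K + d + z)) ∋ solve-∀) (+ K) (+ d₀) z))) Pz
        negative z<0 (no ≮0) = below e
          (ℤP.drop‿+<+ (<-by (<⇒1+≤ z<0 ⊕ ℤP.≤-reflexive +e)
              (((∀ d z e → (+ 0 + (d + z)) - ((+ 1 + z) + e) ≡ d - (+ 1 + e)) ∋ solve-∀) (+ d₀) z (+ e))))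
          (subst (λ y → + 1 ≤ ω y) (trans (((∀ K d z → + 1 - K + d + z ≡ + 1 - K + (d + z)) ∋ solve-∀) (+ K)
              (+ d₀) z) (cong (λ a → + 1 - + K + a) (sym +e))) Pz)
          where
          e = ∣ + d₀ + z ∣
          +e : + e ≡ + d₀ + z
          +e = ℤP.0≤i⇒+∣i∣≡i (ℤP.≮⇒≥ ≮0)

      P-0 : P (+ 0)
      P-0 = subst (λ y → + 1 ≤ ω y) (sym (ℤP.+-identityʳ o)) 1≤ω

      module FromPath {x : Path} (dyck : IsDyck n p x) (H⇒¬P : ∀ {h} → h ∈ H n p x → ¬ P (+ h))
                      (¬P⇒H : ∀ {h} → ¬ P (+ h) → h ∈ H n p x) where

        open DyckPath coprime dyck using (H-unique; H-positive)

        m : ℕ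
        m = width ∸ d₀

        gap? : ∀ h → Dec (ω (o + + h) ≤ + 0)
        gap? h = ω≤0? (o + + h)

        gap<m : ∀ {h} → ω (o + + h) ≤ + 0 → h ℕ.< m
        gap<m {h} ω≤0 = ℕP.≰⇒> λ m≤h → ≤0⇒¬1≤ ω≤0 (far-right
            (≤-by (ℤ.+≤+ m≤h ⊕ ℤP.≤-reflexive (sym at-width) ⊕ ℤP.≤-reflexive (sym (pos-∸ d₀≤width)))
          (((∀ K d w m h → (h + (+ 1 - K + w) + m) - (m + (+ 1 + K) + (w - d)) ≡ (+ 1 - K + d + h) - (+ 1 + K)) ∋
              solve-∀) (+ K) (+ d₀) (+ width) (+ m) (+ h))))

        length-H : length (H n p x) ≡ Σ (λ h → ind (gap? h)) m
        length-H = length-≡-count gap? gap<m H-unique (λ h∈H → ¬1≤⇒≤0 (H⇒¬P h∈H)) (λ ω≤0 → ¬P⇒H (≤0⇒¬1≤ ω≤0))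

        ℓ : ℕ
        ℓ = length (H n p x)

        -- The nonpositive values in the window are those at the `d₀` places before `o` and those at
        -- `o + h` for the ℓ gaps h; `charge` gives their total.
        d₀+ℓ≡K : d₀ ℕ.+ ℓ ≡ K
        d₀+ℓ≡K = begin
          d₀ ℕ.+ ℓ
            ≡⟨ cong (d₀ ℕ.+_) length-H ⟩
          d₀ ℕ.+ Σ (λ h → ind (ω≤0? (o + + h))) m
            ≡⟨ cong₂ ℕ._+_ (sym (Σ-1 d₀ (λ d d<d₀ → ind-yes (ω≤0? (at d)) (¬1≤⇒≤0 (below d d<d₀)))))
                 (Σ-cong m (λ h _ → cong (ind ∘ ω≤0?) (ℤP.+-assoc (+ 1 - + K) (+ d₀) (+ h)))) ⟩
          Σ (λ d → ind (ω≤0? (at d))) d₀ ℕ.+ Σ (λ h → ind (ω≤0? (at (d₀ ℕ.+ h)))) m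
            ≡⟨ Σ-++ _ d₀ m ⟨
          Σ (λ d → ind (ω≤0? (at d))) (d₀ ℕ.+ m)
            ≡⟨ cong (Σ _) (ℕP.m+[n∸m]≡n d₀≤width) ⟩
          Σ (λ d → ind (ω≤0? (at d))) width
            ≡⟨ charge ⟩
          K ∎
          where open ≡-Reasoning

        o≡ : o ≡ + 1 - + ℓ
        o≡ = trans (cong (λ a → + 1 - + a + + d₀) (sym d₀+ℓ≡K))
            (((∀ d l → + 1 - (d + l) + d ≡ + 1 - l) ∋ solve-∀) (+ d₀) (+ ℓ))

        open Hooks H-unique (All.tabulate H-positive) using (α-partitionWithHooks⁻; α-partitionWithHooks⁺)

        α⇒γ : ∀ {z} → InHooks (H n p x) z → Inγ ω z
        α⇒γ (inj₁ (h , h∈ , refl)) = subst (λ y → ω y ≤ + 0)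
            (trans (cong (_+ + h) o≡) (((∀ l h → + 1 - l + h ≡ h + + 1 - l) ∋ solve-∀) (+ ℓ) (+ h)))
                (¬1≤⇒≤0 (H⇒¬P h∈))
        α⇒γ {z} (inj₂ le) = ¬1≤⇒≤0 λ 1≤ → ≤-absurd (P⇒0≤
            (subst (λ y → + 1 ≤ ω y) (((∀ o z → z ≡ o + (z - o)) ∋ solve-∀) o z) 1≤) ⊕ le ⊕ ℤP.≤-reflexive (sym o≡))
          (((∀ z o l → (z - o + - l + o) - (+ 0 + z + (+ 1 - l)) ≡ - + 1) ∋ solve-∀) z o (+ ℓ))

        γ⇒α : ∀ {z} → Inγ ω z → InHooks (H n p x) z
        γ⇒α {z} ω≤0 with z - o ℤ.<? + 0
        ... | yes lt = inj₂ (≤-by (<⇒1+≤ lt ⊕ ℤP.≤-reflexive o≡)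
          (((∀ z o l → (+ 0 + (+ 1 - l)) - ((+ 1 + (z - o)) + o) ≡ - l - z) ∋ solve-∀) z o (+ ℓ)))
        ... | no ≮0 = inj₁ (h , ¬P⇒H (≤0⇒¬1≤ (subst (λ y → ω y ≤ + 0) z≡ ω≤0)) , trans z≡
            (trans (cong (_+ + h) o≡) (((∀ l h → + 1 - l + h ≡ h + + 1 - l) ∋ solve-∀) (+ ℓ) (+ h))))
          where
          h = ∣ z - o ∣
          z≡ : z ≡ o + + h
          z≡ = trans (((∀ o z → z ≡ o + (z - o)) ∋ solve-∀) o z) (cong (ℤ._+_ o) (sym (ℤP.0≤i⇒+∣i∣≡i (ℤP.≮⇒≥ ≮0))))

        is𝒜 : Is𝒜 n p ω x
        is𝒜 = dyck , λ z → α⇒γ ∘ α-partitionWithHooks⁻ , α-partitionWithHooks⁺ ∘ γ⇒α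

      exists : ∃ λ x → Is𝒜 n p ω x
      exists = let x , dyck , H⇒¬P , ¬P⇒H = dyckPath coprime P? (λ {z} → P-+n {z}) (λ {z} → P-+p {z})
                     (λ {z} → P⇒0≤ {z}) P-0
               in x , FromPath.is𝒜 dyck H⇒¬P ¬P⇒H

  exists : ∃ λ x → Is𝒜 n p ω x
  exists = let d , 1≤ω , below = least (λ d → + 1 ℤ.≤? ω (at d)) width (far-right (ℤP.≤-reflexive (sym at-width)))
           in FromFirst.exists d 1≤ω below

-- Duality

dual-dominantStable : ∀ {n p ω} → DominantStable n p ω → DominantStable n p (dual ω)
dual-dominantStable {n} {p} {ω} hyp = record
  { affine = (injective , surjective) , dual-periodic , dual-window-sum
  ; dominant = dual-dominant
  ; stable = dual-stable
  }
  where
  open DominantStable hyp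

  1--injective : ∀ {a b} → + 1 - a ≡ + 1 - b → a ≡ b
  1--injective {a} {b} eq = sym (≡-by eq (((∀ a b → (+ 1 - a) - (+ 1 - b) ≡ b - a) ∋ solve-∀) a b))

  injective : ∀ {x y} → dual ω x ≡ dual ω y → x ≡ y
  injective = 1--injective ∘ ω-injective ∘ 1--injective

  surjective : ∀ y → ∃ λ x → ∀ {z} → z ≡ x → dual ω z ≡ y
  surjective y with ω-surjective (+ 1 - y)
  ... | x , ωx≡ = + 1 - x , λ { refl → trans (cong (λ a → + 1 - ω a) (1-1- x))
      (trans (cong (λ a → + 1 - a) ωx≡) (1-1- y)) }
    where
    1-1- : ∀ z → + 1 - (+ 1 - z) ≡ z
    1-1- = solve-∀

  dual-periodic : ∀ i → dual ω (i + + n) ≡ dual ω i + + n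
  dual-periodic i = trans (cong (λ a → + 1 - a) (trans
      (cong ω (((∀ i n → + 1 - (i + n) ≡ + 1 - i - n) ∋ solve-∀) i (+ n))) (ω-- (+ 1 - i))))
    (((∀ w n → + 1 - (w - n) ≡ + 1 - w + n) ∋ solve-∀) (ω (+ 1 - i)) (+ n))

  -- Position i of the dual window pairs with position n + 1 - i of the original, each pair summing
  -- to n + 1. So the two sums together are n(n + 1), twice the prescribed value.
  dual-window-sum : windowSum n (dual ω) ≡ + ((n ℕ.* suc n) / 2)
  dual-window-sum = trans (foldr-applyUpTo (λ i → dual ω (+ suc i)) n)
      (≡-by doubled (((∀ a s → (a + s) - s * + 2 ≡ a - s) ∋ solve-∀) A S))
    where
    open ≡-Reasoning
    A = ℤSum.Σ (λ i → dual ω (+ suc i)) n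
    S = + ((n ℕ.* suc n) / 2)
    g : ℕ → ℤ
    g j = ω (+ suc j)

    term : ∀ i → i ℕ.< n → dual ω (+ suc i) + g (n ∸ suc i) ≡ + suc n
    term i i<n = begin
      (+ 1 - ω (+ 1 - + suc i)) + g (n ∸ suc i)         ≡⟨ cong (λ a → (+ 1 - ω a) + g (n ∸ suc i)) (trans
                                                             (((∀ i n → + 1 - i ≡ + 1 + (n - i) - n) ∋ solve-∀)
                                                                 (+ suc i) (+ n))
                                                             (cong (λ a → + 1 + a - + n) (sym (pos-∸ i<n)))) ⟩
      (+ 1 - ω (+ suc (n ∸ suc i) - + n)) + g (n ∸ suc i) ≡⟨ cong (λ a → (+ 1 - a) + g (n ∸ suc i))
          (ω-- (+ suc (n ∸ suc i))) ⟩
      (+ 1 - (g (n ∸ suc i) - + n)) + g (n ∸ suc i)     ≡⟨ ((∀ w n → (+ 1 - (w - n)) + w ≡ + 1 + n) ∋ solve-∀)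
          (g (n ∸ suc i)) (+ n) ⟩
      + suc n ∎

    doubled : A + S ≡ S * + 2
    doubled = begin
      A + S                                             ≡⟨ cong (ℤ._+_ A)
          (trans (sym window-sum) (trans (foldr-applyUpTo g n) (ℤSum.Σ-reverse g n))) ⟩
      A + ℤSum.Σ (λ i → g (n ∸ suc i)) n                ≡⟨ ℤSum.Σ-· _ _ n ⟨
      ℤSum.Σ (λ i → dual ω (+ suc i) + g (n ∸ suc i)) n ≡⟨ ℤSum.Σ-cong n term ⟩
      ℤSum.Σ (λ _ → + suc n) n                          ≡⟨ Σ-pos (λ _ → suc n) n ⟨
      + Σ (λ _ → suc n) n                               ≡⟨ cong +_ (Σ-const (suc n) n) ⟩
      + (n ℕ.* suc n)                                   ≡⟨ cong +_ (triangular-doubled n) ⟨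
      + ((n ℕ.+ sum (downFrom n)) ℕ.* 2)                ≡⟨ cong (λ s → + (s ℕ.* 2)) (triangular n) ⟨
      + ((n ℕ.* suc n) / 2 ℕ.* 2)                       ≡⟨ ℤP.pos-* ((n ℕ.* suc n) / 2) 2 ⟩
      S * + 2 ∎

  -- ω takes values between 1 - n and 0 at `1 - a` and `1 - b`; translation by n brings them into
  -- the range of dominance. Values and positions are both reversed, so the order is kept.
  dual-dominant : Dominant n (dual ω)
  dual-dominant a b 1≤a a<b b≤n = <-by (<⇒1+≤ (dominant (+ 1 - b + + n) (+ 1 - a + + n)
      (subst (+ 1 ≤_) (sym (periodic (+ 1 - b))) (≤-by b≤n
          (((∀ w n → n - (+ 1 - w) ≡ (w + n) - + 1) ∋ solve-∀) (ω (+ 1 - b)) (+ n))))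
      (subst₂ _<_ (sym (periodic (+ 1 - b))) (sym (periodic (+ 1 - a))) (<-by (<⇒1+≤ a<b)
        (((∀ u v n → (+ 1 - v) - (+ 1 + (+ 1 - u)) ≡ (u + n) - (+ 1 + (v + n))) ∋ solve-∀) (ω (+ 1 - a))
            (ω (+ 1 - b)) (+ n))))
      (subst (_≤ + n) (sym (periodic (+ 1 - a))) (≤-by 1≤a
          (((∀ u n → (+ 1 - u) - + 1 ≡ n - (u + n)) ∋ solve-∀) (ω (+ 1 - a)) (+ n))))))
    (((∀ a b n → (+ 1 - a + n) - (+ 1 + (+ 1 - b + n)) ≡ b - (+ 1 + a)) ∋ solve-∀) a b (+ n))

  dual-stable : Stable p (dual ω)
  dual-stable i = <-by (<⇒1+≤ (stable (+ 1 - (i + + p)))) (trans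
    (cong (λ a → ω a - (+ 1 + ω (+ 1 - (i + + p)))) (((∀ i p → + 1 - (i + p) + p ≡ + 1 - i) ∋ solve-∀) i (+ p)))
    (((∀ u v → u - (+ 1 + v) ≡ (+ 1 - v) - (+ 1 + (+ 1 - u))) ∋ solve-∀) (ω (+ 1 - i)) (ω (+ 1 - (i + + p)))))

α-conj-dual : ∀ {κ ω} → IsPartition κ → αEqγ κ ω → αEqγ (conj κ) (dual ω)
α-conj-dual {κ} {ω} κ-partition α≡γ z =
    (λ z∈ → flip (ℤP.≰⇒> (α-conj⁻ z∈ ∘ proj₂ (α≡γ (+ 1 - z)))))
  , (λ le → α-conj⁺ (λ 1-z∈ → ≤-absurd (le ⊕ proj₁ (α≡γ (+ 1 - z)) 1-z∈)
      (((∀ w → (+ 0 + + 0) - ((+ 1 - w) + w) ≡ - + 1) ∋ solve-∀) (ω (+ 1 - z)))))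
  where
  open Conjugate κ-partition
  flip : + 0 < ω (+ 1 - z) → + 1 - ω (+ 1 - z) ≤ + 0
  flip lt = ≤-by (<⇒1+≤ lt) (((∀ w → w - (+ 1 + + 0) ≡ + 0 - (+ 1 - w)) ∋ solve-∀) (ω (+ 1 - z)))

-- The search behind φ⁻¹ and η

countN+countE : ∀ x → countN x ℕ.+ countE x ≡ length x
countN+countE []      = refl
countN+countE (N ∷ x) = cong suc (countN+countE x)
countN+countE (E ∷ x) = trans (ℕP.+-suc (countN x) (countE x)) (cong suc (countN+countE x))

∈words : ∀ x → x ∈ words (length x)
∈words []      = here refl
∈words (N ∷ x) = ∈-++⁺ˡ (∈-map⁺ (N ∷_) (∈words x))
∈words (E ∷ x) = ∈-++⁺ʳ (map (N ∷_) (words (length x))) (∈-map⁺ (E ∷_) (∈words x))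

module _ (n p : ℕ) (κ : Partition) where

  private
    preimage? : ∀ y → Dec (IsDyck n p y × φ n p y ≡ κ)
    preimage? y = isDyck? n p y ×-dec LP.≡-dec ℕ._≟_ (φ n p y) κ

  -- A Dyck path has length n + p, so `y` is among the words searched and the filtered list is
  -- nonempty; its head passes the same test as `y`.
  φ⁻¹-finds : ∀ {y} → IsDyck n p y → φ n p y ≡ κ → ∃ λ y′ → φ⁻¹ n p κ ≡ just y′ × IsDyck n p y′ × φ n p y′ ≡ κ
  φ⁻¹-finds {y} dyck φy≡κ = search _ refl
    where
    y∈ : y ∈ filter preimage? (words (n ℕ.+ p))
    y∈ = ∈-filter⁺ preimage? (subst (λ k → y ∈ words k)
      (trans (sym (countN+countE y)) (cong₂ ℕ._+_ (proj₁ dyck) (proj₁ (proj₂ dyck)))) (∈words y)) (dyck , φy≡κ)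
    search : ∀ ys → filter preimage? (words (n ℕ.+ p)) ≡ ys → ∃ λ y′ → φ⁻¹ n p κ ≡ just y′ × IsDyck n p y′ × φ n p y′
        ≡ κ
    search [] eq with () ← subst (y ∈_) eq y∈
    search (y′ ∷ ys) eq = y′ , found , proj₂ (∈-filter⁻ preimage? {xs = words (n ℕ.+ p)}
        (subst (y′ ∈_) (sym eq) (here refl)))
      where
      found : φ⁻¹ n p κ ≡ just y′
      found rewrite eq = refl

η≡ : ∀ n p {x y} → φ⁻¹ n p (conj (φ n p x)) ≡ just y → η n p x ≡ just (zeta n p y)
η≡ n p eq rewrite eq = refl

theorem3p4 : (n p : ℕ) → .{{_ : NonZero n}} → .{{_ : NonZero p}} → Coprime n p →
    (ω : ℤ → ℤ) → IsAffinePerm n ω → Dominant n ω → Stable p ω →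
    (∃ λ x → Is𝒜 n p ω x)
    × (∀ x → Is𝒜 n p ω x →
    (complement (zeta n p x) ≡ applyDownFrom (λ i → PS n p ω (suc i)) n)
    × (Data.Maybe.map complement (η n p x)
    ≡ just (applyDownFrom (λ i → PS* n p ω (suc i)) n)))
theorem3p4 n p coprime ω affine dominant stable =
  Existence.exists coprime hyp , λ x is𝒜 → PakStanley.complement-zeta coprime hyp is𝒜 , dual-part is𝒜
      (Existence.exists coprime hyp*)
  where
  hyp : DominantStable n p ω
  hyp = record { affine = affine ; dominant = dominant ; stable = stable }
  hyp* = dual-dominantStable hyp

  φ-isPartition : ∀ {x} → IsDyck n p x → IsPartition (φ n p x)
  φ-isPartition dyck = Hooks.isPartition H-unique (All.tabulate H-positive)
    where open DyckPath coprime dyck using (H-unique; H-positive)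

  dual-part : ∀ {x} → Is𝒜 n p ω x → (∃ λ y → Is𝒜 n p (dual ω) y) →
              Data.Maybe.map complement (η n p x) ≡ just (applyDownFrom (λ i → PS* n p ω (suc i)) n)
  dual-part {x} (dyck , α≡γ) (y , y-dyck , α≡γ*) = conclude (φ⁻¹-finds n p (conj (φ n p x)) y-dyck φy≡)
    where
    α-conj : αEqγ (conj (φ n p x)) (dual ω)
    α-conj = α-conj-dual (φ-isPartition dyck) α≡γ

    -- The path for ω* is a preimage of the conjugate core, which makes the search in `η` succeed.
    φy≡ : φ n p y ≡ conj (φ n p x)
    φy≡ = α-injective (φ-isPartition y-dyck) (Conjugate.conj-isPartition (φ-isPartition dyck))
      (λ {z} → proj₂ (α-conj z) ∘ proj₁ (α≡γ* z)) (λ {z} → proj₂ (α≡γ* z) ∘ proj₁ (α-conj z))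

    -- The path `y′` found by the search satisfies `Is𝒜` for `dual ω` in its own right, because it
    -- has the core `conj (φ n p x)`.
    conclude : (∃ λ y′ → φ⁻¹ n p (conj (φ n p x)) ≡ just y′ × IsDyck n p y′ × φ n p y′ ≡ conj (φ n p x)) →
               Data.Maybe.map complement (η n p x) ≡ just (applyDownFrom (λ i → PS* n p ω (suc i)) n)
    conclude (y′ , found , y′-dyck , φy′≡) = trans (cong (Data.Maybe.map complement) (η≡ n p {x} found))
      (cong just (PakStanley.complement-zeta coprime hyp*
          (y′-dyck , subst (λ κ → αEqγ κ (dual ω)) (sym φy′≡) α-conj)))
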